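{- Let $a$ be an integral closed 2-frieze of width $m\ge 1$ and $b$ an integral closed 2-frieze of width $\ell\ge 1$, and let $c,d\in\mathbb{Z}$ be such that the last non-trivial row of $a$ in columns $c,c+1$ and the first non-trivial row of $b$ in columns $d,d+1$ contain the same pair $x,y$: $$x=a(m,c)=b(1,d),\qquad y=a(m,c+1)=b(1,d+1).$$ Put $$r=a(m-1,c),\quad s=a(m-1,c+1),\quad u=b(2,d),\quad v=b(2,d+1).$$ Gluing the two pairs of columns over the common pair $x,y$ gives an integral closed 2-frieze of width $m+\ell-1$, that is, there is an integral closed 2-frieze $w$ of width $m+\ell-1$ such that, for $\epsilon\in\{0,1\}$, $$w(i,\epsilon)=a(i,c+\epsilon)\ \text{ for } 0\le i\le m,\qquad w(m-1+i,\epsilon)=b(i,d+\epsilon)\ \text{ for } 1\le i\le \ell+1,$$ if and only if $$u\equiv r\equiv 1 \bmod y\qquad\text{and}\qquad v\equiv s\equiv 1 \bmod x .$$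
   Context: A closed 2-frieze of width $m$ is an array $a(r,c)$, with rows $r\in\{0,1,\dots,m+1\}$ (numbered from top to bottom) and columns $c\in\mathbb{Z}$ (numbered from left to right), whose top and bottom rows consist of 1s, i.e. $a(0,c)=a(m+1,c)=1$ for all $c\in\mathbb{Z}$, and which satisfies the local rule $$a(r,c)=a(r,c-1)\,a(r,c+1)-a(r-1,c)\,a(r+1,c)\qquad (1\le r\le m,\ c\in\mathbb{Z}).$$ A closed 2-frieze is integral if all its entries are positive integers. -}

module Defs where

open import Data.Nat as ℕ using (ℕ; suc)
open import Data.Integer using (ℤ; 0ℤ; 1ℤ; _+_; _-_; _*_; _<_)
open import Data.Integer.Divisibility.Signed using (_∣_)
open import Relation.Binary.PropositionalEquality using (_≡_)

-- An array is applied to the row first, then to the column.  A frieze of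
-- width m only has rows 0, …, m + 1: everything below constrains these rows
-- alone, and the values in rows beyond m + 1 are junk.
Array : Set
Array = ℕ → ℤ → ℤ

record IsClosed2Frieze (m : ℕ) (a : Array) : Set where
  field
    top    : ∀ c → a 0 c ≡ 1ℤ
    bottom : ∀ c → a (suc m) c ≡ 1ℤ
    -- The rule at row r = suc i, so that i < m amounts to 1 ≤ r ≤ m.
    rule   : ∀ i → i ℕ.< m → ∀ c →
             a (suc i) c ≡ a (suc i) (c - 1ℤ) * a (suc i) (c + 1ℤ) - a i c * a (suc (suc i)) c

-- Integrality of the entries is already part of Array.
record IsIntegralClosed2Frieze (m : ℕ) (a : Array) : Set where
  field
    isClosed2Frieze : IsClosed2Frieze m a
    positive        : ∀ i → i ℕ.≤ suc m → ∀ c → 0ℤ < a i c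

infix 4 _≡_[mod_]

_≡_[mod_] : ℤ → ℤ → ℤ → Set
p ≡ q [mod n ] = n ∣ p - q

-- If L is a sequence in ℤ³ with L k ⨯ L (2 + k) ≡ L (1 + k) and L k ∙ L (3 + k) ≡ 1, then the
-- array L (c - r) ∙ L (c + r + 3) satisfies the 2-frieze rule by the Binet–Cauchy identity, and it
-- is closed of width n once L has period 2 n + 8.  (Every other L k is a vertex of a polygon in ℤ³,
-- the remaining ones are the cross products of consecutive vertices.)  Conversely every integral
-- closed 2-frieze arises in this way, and the first three vertices can be chosen freely as long as
-- their determinant is 1.
--
-- The rule at the last row of a and at the first row of b gives y ∣ x + r, y ∣ x + u, x ∣ y + s and
-- x ∣ y + v.  So u ≡ r and v ≡ s always hold, and the congruences of the theorem amount to
-- y ∣ x + 1 and x ∣ y + 1, hence to x y ∣ x + y + 1.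
--
-- Sufficiency: if κ x y = x + y + 1, coordinates can be chosen so that the four vectors that carry
-- x and y are the same for a and for b, with all remaining vectors integral.  The two sequences are
-- then glued along these vectors to a sequence of period 2 (m + ℓ - 1) + 8.
--
-- Necessity: w and a agree in the light cone of the common columns, and along its boundary they
-- differ by multiples of (v - 1) / x.  The multiple is 1 in the first row, so x ∣ v - 1; the
-- mirror image gives y ∣ u - 1.

module Submission where

open import Defs
open import Data.Empty using (⊥-elim)
open import Data.Fin using (Fin; toℕ; zero; suc)
open import Data.Fin.Properties using (toℕ≤pred[n])
open import Data.Integer hiding (suc; positive)
open import Data.Integer.Divisibility.Signed
open import Data.Integer.DivMod using (_%ℕ_; _/ℕ_; n%ℕd<d; a≡a%ℕn+[a/ℕn]*n)
open import Data.Integer.Properties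
open import Data.Integer.Solver using (module +-*-Solver)
open import Data.Integer.Tactic.RingSolver using (solve-∀)
open import Data.Nat as ℕ using (ℕ; zero; suc; z≤n; s≤s; _∸_)
open import Data.Nat.Properties as ℕ using ()
import Data.Nat.Tactic.RingSolver as ℕ-Solver
open import Data.Product using (∃; _×_; _,_; proj₁; proj₂)
open import Data.Sum using (inj₁; inj₂; [_,_]′)
open import Function.Bundles using (_⇔_; mk⇔)
open import Relation.Binary.PropositionalEquality

-- Vector algebra in ℤ³.

record Triple (A : Set) : Set where
  constructor ⟨_,_,_⟩
  field x₁ x₂ x₃ : A

-- Parametrised by the arithmetic, so that the same formulas serve integer vectors and the symbolic
-- polynomials of the ring solver.
module VectorOperations {A : Set} (_+_ _*_ _-_ : A → A → A) where
  infixl 7 _∙_ _•_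
  infixl 8 _⨯_
  infixl 6 _⊹_

  _∙_ : Triple A → Triple A → A
  ⟨ a , b , c ⟩ ∙ ⟨ d , e , f ⟩ = ((a * d) + (b * e)) + (c * f)

  _⨯_ : Triple A → Triple A → Triple A
  ⟨ a , b , c ⟩ ⨯ ⟨ d , e , f ⟩ = ⟨ (b * f) - (c * e) , (c * d) - (a * f) , (a * e) - (b * d) ⟩

  _•_ : A → Triple A → Triple A
  k • ⟨ a , b , c ⟩ = ⟨ k * a , k * b , k * c ⟩

  _⊹_ : Triple A → Triple A → Triple A
  ⟨ a , b , c ⟩ ⊹ ⟨ d , e , f ⟩ = ⟨ a + d , b + e , c + f ⟩

  det : Triple A → Triple A → Triple A → A
  det P Q R = P ∙ (Q ⨯ R)

ℤ³ : Set
ℤ³ = Triple ℤ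

e₁ e₂ e₃ : ℤ³
e₁ = ⟨ 1ℤ , 0ℤ , 0ℤ ⟩
e₂ = ⟨ 0ℤ , 1ℤ , 0ℤ ⟩
e₃ = ⟨ 0ℤ , 0ℤ , 1ℤ ⟩

private module ℤ-Operations = VectorOperations _+_ _*_ _-_

-- Later goals thus treat vectors as atoms; only the polynomial identities in the next opaque block
-- look at coordinates.
opaque
  infixl 7 _∙_ _•_
  infixl 8 _⨯_
  infixl 6 _⊹_

  _∙_ : ℤ³ → ℤ³ → ℤ
  _∙_ = ℤ-Operations._∙_

  _⨯_ _⊹_ : ℤ³ → ℤ³ → ℤ³
  _⨯_ = ℤ-Operations._⨯_
  _⊹_ = ℤ-Operations._⊹_

  _•_ : ℤ → ℤ³ → ℤ³
  _•_ = ℤ-Operations._•_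

det : ℤ³ → ℤ³ → ℤ³ → ℤ
det P Q R = P ∙ (Q ⨯ R)

open +-*-Solver using (Polynomial; solve; con; _:+_; _:*_; _:-_; _:=_)
open module PolynomialOperations {n} = VectorOperations {Polynomial n} _:+_ _:*_ _:-_
  using () renaming (_∙_ to _:∙_; _⨯_ to _:⨯_; _•_ to _:•_; _⊹_ to _:⊹_; det to :det)

opaque
  unfolding _∙_

  ∙-comm : ∀ P Q → P ∙ Q ≡ Q ∙ P
  ∙-comm ⟨ a , b , c ⟩ ⟨ d , e , f ⟩ =
    solve 6 (λ a b c d e f → let P = ⟨ a , b , c ⟩ ; Q = ⟨ d , e , f ⟩ in
      P :∙ Q := Q :∙ P) refl a b c d e f

  binet-cauchy : ∀ P Q R S → (P ⨯ Q) ∙ (R ⨯ S) ≡ (P ∙ R) * (Q ∙ S) - (P ∙ S) * (Q ∙ R)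
  binet-cauchy ⟨ a , b , c ⟩ ⟨ d , e , f ⟩ ⟨ g , h , i ⟩ ⟨ j , k , l ⟩ =
    solve 12 (λ a b c d e f g h i j k l →
      let P = ⟨ a , b , c ⟩ ; Q = ⟨ d , e , f ⟩ ; R = ⟨ g , h , i ⟩ ; S = ⟨ j , k , l ⟩ in
      (P :⨯ Q) :∙ (R :⨯ S) := (P :∙ R) :* (Q :∙ S) :- (P :∙ S) :* (Q :∙ R))
      refl a b c d e f g h i j k l

  lagrange : ∀ P Q R S → (P ⨯ (Q ⨯ R)) ∙ S ≡ (P ∙ R) * (Q ∙ S) - (P ∙ Q) * (R ∙ S)
  lagrange ⟨ a , b , c ⟩ ⟨ d , e , f ⟩ ⟨ g , h , i ⟩ ⟨ j , k , l ⟩ =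
    solve 12 (λ a b c d e f g h i j k l →
      let P = ⟨ a , b , c ⟩ ; Q = ⟨ d , e , f ⟩ ; R = ⟨ g , h , i ⟩ ; S = ⟨ j , k , l ⟩ in
      (P :⨯ (Q :⨯ R)) :∙ S := (P :∙ R) :* (Q :∙ S) :- (P :∙ Q) :* (R :∙ S))
      refl a b c d e f g h i j k l

  ∙-⨯ˡ : ∀ P Q → P ∙ (P ⨯ Q) ≡ 0ℤ
  ∙-⨯ˡ ⟨ a , b , c ⟩ ⟨ d , e , f ⟩ =
    solve 6 (λ a b c d e f → let P = ⟨ a , b , c ⟩ ; Q = ⟨ d , e , f ⟩ in
      P :∙ (P :⨯ Q) := con 0ℤ) refl a b c d e f

  ∙-⨯ʳ : ∀ P Q → Q ∙ (P ⨯ Q) ≡ 0ℤ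
  ∙-⨯ʳ ⟨ a , b , c ⟩ ⟨ d , e , f ⟩ =
    solve 6 (λ a b c d e f → let P = ⟨ a , b , c ⟩ ; Q = ⟨ d , e , f ⟩ in
      Q :∙ (P :⨯ Q) := con 0ℤ) refl a b c d e f

  ∙-linear : ∀ P k Q R → P ∙ (k • Q ⊹ R) ≡ k * (P ∙ Q) + P ∙ R
  ∙-linear ⟨ a , b , c ⟩ k ⟨ d , e , f ⟩ ⟨ g , h , i ⟩ =
    solve 10 (λ a b c k d e f g h i →
      let P = ⟨ a , b , c ⟩ ; Q = ⟨ d , e , f ⟩ ; R = ⟨ g , h , i ⟩ in
      P :∙ (k :• Q :⊹ R) := (k :* (P :∙ Q)) :+ (P :∙ R)) refl a b c k d e f g h i

  det-cyclic : ∀ P Q R → det P Q R ≡ det Q R P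
  det-cyclic ⟨ a , b , c ⟩ ⟨ d , e , f ⟩ ⟨ g , h , i ⟩ =
    solve 9 (λ a b c d e f g h i →
      let P = ⟨ a , b , c ⟩ ; Q = ⟨ d , e , f ⟩ ; R = ⟨ g , h , i ⟩ in
      :det P Q R := :det Q R P) refl a b c d e f g h i

  -- Cramer's rule in the basis dual to P, Q, R.
  cramer : ∀ P Q R X Y → det P Q R * (X ∙ Y) ≡
           (X ∙ P) * det Y Q R + (X ∙ Q) * det Y R P + (X ∙ R) * det Y P Q
  cramer ⟨ a , b , c ⟩ ⟨ d , e , f ⟩ ⟨ g , h , i ⟩ ⟨ j , k , l ⟩ ⟨ m , n , o ⟩ =
    solve 15 (λ a b c d e f g h i j k l m n o →
      let P = ⟨ a , b , c ⟩ ; Q = ⟨ d , e , f ⟩ ; R = ⟨ g , h , i ⟩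
          X = ⟨ j , k , l ⟩ ; Y = ⟨ m , n , o ⟩ in
      :det P Q R :* (X :∙ Y) :=
      (((X :∙ P) :* :det Y Q R) :+ ((X :∙ Q) :* :det Y R P)) :+ ((X :∙ R) :* :det Y P Q))
      refl a b c d e f g h i j k l m n o

  ∙-e₁ : ∀ a b c → ⟨ a , b , c ⟩ ∙ e₁ ≡ a
  ∙-e₁ = solve 3 (λ a b c → ⟨ a , b , c ⟩ :∙ ⟨ con 1ℤ , con 0ℤ , con 0ℤ ⟩ := a) refl

  ∙-e₂ : ∀ a b c → ⟨ a , b , c ⟩ ∙ e₂ ≡ b
  ∙-e₂ = solve 3 (λ a b c → ⟨ a , b , c ⟩ :∙ ⟨ con 0ℤ , con 1ℤ , con 0ℤ ⟩ := b) refl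

  ∙-e₃ : ∀ a b c → ⟨ a , b , c ⟩ ∙ e₃ ≡ c
  ∙-e₃ = solve 3 (λ a b c → ⟨ a , b , c ⟩ :∙ ⟨ con 0ℤ , con 0ℤ , con 1ℤ ⟩ := c) refl

  det-e₁e₂e₃ : det e₁ e₂ e₃ ≡ 1ℤ
  det-e₁e₂e₃ = refl

  det-gluing-frame : ∀ x y κ → det ⟨ y , 1ℤ , 0ℤ ⟩ ⟨ 1ℤ , κ , 1ℤ ⟩ ⟨ 0ℤ , 1ℤ , x ⟩ ≡ κ * (x * y) - x - y
  det-gluing-frame = solve 3 (λ x y κ →
    :det ⟨ y , con 1ℤ , con 0ℤ ⟩ ⟨ con 1ℤ , κ , con 1ℤ ⟩ ⟨ con 0ℤ , con 1ℤ , x ⟩ :=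
    κ :* (x :* y) :- x :- y) refl

∙-injective : ∀ P Q → (∀ X → P ∙ X ≡ Q ∙ X) → P ≡ Q
∙-injective ⟨ a , b , c ⟩ ⟨ d , e , f ⟩ eq
  with refl ← trans (sym (∙-e₁ a b c)) (trans (eq e₁) (∙-e₁ d e f))
     | refl ← trans (sym (∙-e₂ a b c)) (trans (eq e₂) (∙-e₂ d e f))
     | refl ← trans (sym (∙-e₃ a b c)) (trans (eq e₃) (∙-e₃ d e f)) = refl

-- By `cramer` with determinant 1, `X ∙ Z` is an integer combination of the three products for every
-- `Z`. This test later identifies vectors, both for the period and at the seams of the gluing.
∙-injective-frame : ∀ {P Q R} → det P Q R ≡ 1ℤ → ∀ {X Y} →
                    X ∙ P ≡ Y ∙ P → X ∙ Q ≡ Y ∙ Q → X ∙ R ≡ Y ∙ R → X ≡ Y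
∙-injective-frame {P} {Q} {R} det≡1 {X} {Y} eqP eqQ eqR = ∙-injective X Y λ Z → begin
  X ∙ Z                 ≡⟨ unit X Z ⟨
  det P Q R * (X ∙ Z)   ≡⟨ cramer P Q R X Z ⟩
  (X ∙ P) * det Z Q R + (X ∙ Q) * det Z R P + (X ∙ R) * det Z P Q
    ≡⟨ cong₂ _+_ (cong₂ _+_ (cong (_* _) eqP) (cong (_* _) eqQ)) (cong (_* _) eqR) ⟩
  (Y ∙ P) * det Z Q R + (Y ∙ Q) * det Z R P + (Y ∙ R) * det Z P Q
    ≡⟨ cramer P Q R Y Z ⟨
  det P Q R * (Y ∙ Z)   ≡⟨ unit Y Z ⟩
  Y ∙ Z                 ∎
  where
  open ≡-Reasoning
  unit : ∀ U V → det P Q R * (U ∙ V) ≡ U ∙ V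
  unit U V = trans (cong (_* (U ∙ V)) det≡1) (*-identityˡ (U ∙ V))

⨯-⨯ : ∀ P Q R → P ∙ Q ≡ 0ℤ → P ∙ R ≡ 1ℤ → P ⨯ (Q ⨯ R) ≡ Q
⨯-⨯ P Q R P∙Q≡0 P∙R≡1 = ∙-injective _ _ λ X → begin
  (P ⨯ (Q ⨯ R)) ∙ X                     ≡⟨ lagrange P Q R X ⟩
  (P ∙ R) * (Q ∙ X) - (P ∙ Q) * (R ∙ X)
    ≡⟨ cong₂ (λ s t → s * (Q ∙ X) - t * (R ∙ X)) P∙R≡1 P∙Q≡0 ⟩
  1ℤ * (Q ∙ X) - 0ℤ * (R ∙ X)           ≡⟨ simplify (Q ∙ X) (R ∙ X) ⟩
  Q ∙ X                                 ∎
  where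
  open ≡-Reasoning
  simplify : ∀ s t → 1ℤ * s - 0ℤ * t ≡ s
  simplify = solve-∀

-- `P ⨯ Q` is orthogonal to `Q` and has product 1 with `R`. So passing to cross products of
-- neighbours twice gives the original vectors back.
⨯-⨯-middle : ∀ P Q R → det P Q R ≡ 1ℤ → (P ⨯ Q) ⨯ (Q ⨯ R) ≡ Q
⨯-⨯-middle P Q R det≡1 = ⨯-⨯ (P ⨯ Q) Q R
  (trans (∙-comm (P ⨯ Q) Q) (∙-⨯ʳ P Q))
  (trans (∙-comm (P ⨯ Q) R) (trans (det-cyclic R P Q) det≡1))

-- A multiple of `P` is invisible to the cross product with `P`. Hence the first-row entry `k` in
-- `step` can be prescribed freely without disturbing the vectors already constructed.
⨯-shear : ∀ P k Q → P ⨯ (k • P ⊹ Q) ≡ P ⨯ Q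
⨯-shear P k Q = ∙-injective _ _ λ X → begin
  (P ⨯ (k • P ⊹ Q)) ∙ X         ≡⟨ rotate (k • P ⊹ Q) X ⟩
  (X ⨯ P) ∙ (k • P ⊹ Q)         ≡⟨ ∙-linear (X ⨯ P) k P Q ⟩
  k * ((X ⨯ P) ∙ P) + (X ⨯ P) ∙ Q
    ≡⟨ cong (λ s → k * s + (X ⨯ P) ∙ Q) (trans (∙-comm (X ⨯ P) P) (∙-⨯ʳ X P)) ⟩
  k * 0ℤ + (X ⨯ P) ∙ Q          ≡⟨ simplify k ((X ⨯ P) ∙ Q) ⟩
  (X ⨯ P) ∙ Q                   ≡⟨ rotate Q X ⟨
  (P ⨯ Q) ∙ X                   ∎
  where
  open ≡-Reasoning
  simplify : ∀ s t → s * 0ℤ + t ≡ t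
  simplify = solve-∀
  rotate : ∀ R X → (P ⨯ R) ∙ X ≡ (X ⨯ P) ∙ R
  rotate R X = trans (∙-comm (P ⨯ R) X) (trans (sym (det-cyclic R X P)) (∙-comm R (X ⨯ P)))

-- Frieze entries as products of integer vectors

record Fan (L : ℕ → ℤ³) : Set where
  field
    cross : ∀ k → L k ⨯ L (2 ℕ.+ k) ≡ L (1 ℕ.+ k)
    unit  : ∀ k → L k ∙ L (3 ℕ.+ k) ≡ 1ℤ

record Frame : Set where
  constructor frame
  field
    P Q R      : ℤ³
    unimodular : det P Q R ≡ 1ℤ

open Frame

-- From L i, L (2 + i), L (4 + i) to the same vectors for suc i.  The last of them, L (5 + i), has
-- the products k, 1 and 0 with P, Q and R; the product k is the entry in the first row.
step : ℤ → Frame → Frame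
step k (frame P Q R unimodular) = frame (P ⨯ Q) (Q ⨯ R) (k • (Q ⨯ R) ⊹ R ⨯ P) (begin
  (P ⨯ Q) ∙ ((Q ⨯ R) ⨯ (k • (Q ⨯ R) ⊹ R ⨯ P)) ≡⟨ cong ((P ⨯ Q) ∙_) (⨯-shear (Q ⨯ R) k (R ⨯ P)) ⟩
  (P ⨯ Q) ∙ ((Q ⨯ R) ⨯ (R ⨯ P))
    ≡⟨ cong ((P ⨯ Q) ∙_) (⨯-⨯-middle Q R P (trans (sym (det-cyclic P Q R)) unimodular)) ⟩
  (P ⨯ Q) ∙ R                                 ≡⟨ ∙-comm (P ⨯ Q) R ⟩
  det R P Q                                   ≡⟨ trans (det-cyclic R P Q) unimodular ⟩
  1ℤ                                          ∎)
  where open ≡-Reasoning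

module FanConstruction (F₀ : Frame) (f : ℕ → ℤ) where

  frames : ℕ → Frame
  frames zero    = F₀
  frames (suc k) = step (f k) (frames k)

  opaque
    L : ℕ → ℤ³
    L k = P (frames k)

    L-0 : L 0 ≡ P F₀
    L-0 = refl

    -- Two steps turn `P` into `(P ⨯ Q) ⨯ (Q ⨯ R)` by mere computation.
    L-2+ : ∀ k → L (2 ℕ.+ k) ≡ Q (frames k)
    L-2+ k with frames k
    ... | frame P Q R unimodular = ⨯-⨯-middle P Q R unimodular

    L-4+ : ∀ k → L (4 ℕ.+ k) ≡ R (frames k)
    L-4+ k = trans (L-2+ (2 ℕ.+ k)) (lemma (f k) (frames k))
      where
      lemma : ∀ t F → Q (step t F) ⨯ R (step t F) ≡ R F
      lemma t (frame P Q R unimodular) =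
        trans (⨯-shear (Q ⨯ R) t (R ⨯ P)) (⨯-⨯-middle Q R P (trans (sym (det-cyclic P Q R)) unimodular))

    isFan : Fan L
    isFan = record
      { cross = λ k → cong (L k ⨯_) (L-2+ k)
      ; unit  = λ k → trans (cong (L k ∙_) (L-3+ k)) (unimodular (frames k))
      }
      where
      L-3+ : ∀ k → L (3 ℕ.+ k) ≡ Q (frames k) ⨯ R (frames k)
      L-3+ k = L-2+ (suc k)

    L∙L-5+ : ∀ k → L k ∙ L (5 ℕ.+ k) ≡ f k
    L∙L-5+ k = trans (cong (L k ∙_) (L-4+ (suc k))) (lemma (f k) (frames k))
      where
      lemma : ∀ t F → P F ∙ R (step t F) ≡ t
      lemma t (frame P Q R unimodular) = begin
        P ∙ (t • (Q ⨯ R) ⊹ R ⨯ P)       ≡⟨ ∙-linear P t (Q ⨯ R) (R ⨯ P) ⟩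
        t * det P Q R + P ∙ (R ⨯ P)     ≡⟨ cong₂ (λ x y → t * x + y) unimodular (∙-⨯ʳ R P) ⟩
        t * 1ℤ + 0ℤ                     ≡⟨ trans (+-identityʳ _) (*-identityʳ t) ⟩
        t                               ∎
        where open ≡-Reasoning

-- Half friezes

pos-cancel : ∀ i {j k} → 0ℤ < i → i * j ≡ i * k → j ≡ k
pos-cancel i {j} {k} 0<i = *-cancelˡ-≡ i j k {{>-nonZero 0<i}}

pos-+* : ∀ {i j k} → 0ℤ < i → 0ℤ < j → 0ℤ < k → 0ℤ < i + j * k
pos-+* (+<+ (s≤s _)) (+<+ (s≤s _)) (+<+ (s≤s _)) = +<+ (s≤s z≤n)

pos-*⁻ : ∀ {i j} → 0ℤ < i → 0ℤ < i * j → 0ℤ < j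
pos-*⁻ {+ suc n} {j} _ 0<ij =
  *-cancelˡ-<-nonNeg (+ suc n) (subst (_< + suc n * j) (sym (*-zeroʳ (+ suc n))) 0<ij)
pos-*⁻ {+ 0} (+<+ ())

-- The columns of a frieze on one side of a given column, read away from it.
record IsClosedRay (m : ℕ) (α : ℕ → ℕ → ℤ) : Set where
  field
    top    : ∀ k → α 0 k ≡ 1ℤ
    bottom : ∀ k → α (suc m) k ≡ 1ℤ
    rule   : ∀ i → i ℕ.< m → ∀ k → α (1 ℕ.+ i) k * α (1 ℕ.+ i) (2 ℕ.+ k) ≡
             α (1 ℕ.+ i) (1 ℕ.+ k) + α i (1 ℕ.+ k) * α (2 ℕ.+ i) (1 ℕ.+ k)

record IsPositiveRay (m : ℕ) (α : ℕ → ℕ → ℤ) : Set where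
  field
    isClosedRay : IsClosedRay m α
    positive    : ∀ i → i ℕ.≤ suc m → ∀ k → 0ℤ < α i k
  open IsClosedRay isClosedRay public

right left : Array → ℤ → ℕ → ℕ → ℤ
right a c i k = a i (c + + k)
left  a c i k = a i (c - + k)

private
  unsubtract : ∀ {p q r} → p ≡ q - r → q ≡ p + r
  unsubtract {p} {q} {r} refl = lemma q r
    where
    lemma : ∀ q r → q ≡ q - r + r
    lemma = solve-∀

module _ {m a} (closed : IsClosed2Frieze m a) where
  open IsClosed2Frieze closed

  right-closed : ∀ c → IsClosedRay m (right a c)
  right-closed c = record
    { top    = λ k → top _
    ; bottom = λ k → bottom _
    ; rule   = λ i i<m k → trans
        (cong₂ (λ s t → a (suc i) s * a (suc i) t) (sym (pred-column c (+ k))) (sym (suc-column c (+ k))))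
        (unsubtract (rule i i<m (c + (1ℤ + + k))))
    }
    where
    pred-column : ∀ c k → c + (1ℤ + k) - 1ℤ ≡ c + k
    pred-column = solve-∀
    suc-column : ∀ c k → c + (1ℤ + k) + 1ℤ ≡ c + (1ℤ + (1ℤ + k))
    suc-column = solve-∀

  -- The rule is symmetric in the two neighbouring columns, so every lemma on rays also yields its
  -- mirror image.
  left-closed : ∀ c → IsClosedRay m (left a c)
  left-closed c = record
    { top    = λ k → top _
    ; bottom = λ k → bottom _
    ; rule   = λ i i<m k → trans
        (trans (*-comm (a (suc i) (c - + k)) _)
          (cong₂ (λ s t → a (suc i) s * a (suc i) t) (sym (pred-column c (+ k))) (sym (suc-column c (+ k)))))
        (unsubtract (rule i i<m (c - (1ℤ + + k))))
    }
    where
    pred-column : ∀ c k → c - (1ℤ + k) - 1ℤ ≡ c - (1ℤ + (1ℤ + k))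
    pred-column = solve-∀
    suc-column : ∀ c k → c - (1ℤ + k) + 1ℤ ≡ c - k
    suc-column = solve-∀

module _ {m a} (integral : IsIntegralClosed2Frieze m a) where
  open IsIntegralClosed2Frieze integral

  right-positive : ∀ c → IsPositiveRay m (right a c)
  right-positive c = record { isClosedRay = right-closed isClosed2Frieze c ; positive = λ i i≤ k → positive i i≤ _ }

  left-positive : ∀ c → IsPositiveRay m (left a c)
  left-positive c = record { isClosedRay = left-closed isClosed2Frieze c ; positive = λ i i≤ k → positive i i≤ _ }

-- By the rule, a positive entry times the entry two columns further is positive. So positivity
-- spreads from two adjacent columns, which is how the glued array is shown to be positive.
ray-positive : ∀ {m α} → IsClosedRay m α →
               (∀ i → i ℕ.≤ suc m → 0ℤ < α i 0) → (∀ i → i ℕ.≤ suc m → 0ℤ < α i 1) →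
               ∀ k i → i ℕ.≤ suc m → 0ℤ < α i k
ray-positive {m} {α} closed pos₀ pos₁ = λ k → proj₁ (both k)
  where
  open IsClosedRay closed
  both : ∀ k → (∀ i → i ℕ.≤ suc m → 0ℤ < α i k) × (∀ i → i ℕ.≤ suc m → 0ℤ < α i (suc k))
  both zero    = pos₀ , pos₁
  both (suc k) with pos , pos′ ← both k = pos′ , next
    where
    next : ∀ i → i ℕ.≤ suc m → 0ℤ < α i (2 ℕ.+ k)
    next zero    _ = subst (0ℤ <_) (sym (top _)) (+<+ (s≤s z≤n))
    next (suc i) (s≤s i≤m) with ℕ.m≤n⇒m<n∨m≡n i≤m
    ... | inj₂ refl = subst (0ℤ <_) (sym (bottom _)) (+<+ (s≤s z≤n))
    ... | inj₁ i<m  = pos-*⁻ (pos (suc i) (s≤s i≤m))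
      (subst (0ℤ <_) (sym (rule i i<m k))
        (pos-+* (pos′ (suc i) (s≤s i≤m)) (pos′ i (ℕ.m≤n⇒m≤1+n i≤m)) (pos′ (suc (suc i)) (s≤s i<m))))

-- Comparison of two rays in a light cone.

-- Writing x for α (suc m) 0 and v for β (2 + m) 1, the difference β - α is (v - 1) / x times the
-- neighbouring entry of α all along the boundary of the light cone.  In the first row this entry
-- is 1, so (v - 1) / x is an integer.
module _ {m n α β} (α-ray : IsPositiveRay (suc m) α) (β-ray : IsPositiveRay n β) (m<n : m ℕ.< n)
         (agree₀ : ∀ i → i ℕ.≤ suc m → β i 0 ≡ α i 0)
         (agree₁ : ∀ i → i ℕ.≤ suc m → β i 1 ≡ α i 1) where
  private
    module α = IsPositiveRay α-ray
    module β = IsPositiveRay β-ray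

  -- Dividing the rule by a positive entry determines column `2 + j` from the two columns before it,
  -- but the row below is needed too: each column costs one row, hence the bound on `i + j`.
  cone : ∀ j i → i ℕ.+ j ℕ.≤ suc m → β i j ≡ α i j × β i (suc j) ≡ α i (suc j)
  cone zero    i i+0≤ = agree₀ i i≤ , agree₁ i i≤
    where i≤ = subst (ℕ._≤ suc m) (ℕ.+-identityʳ i) i+0≤
  cone (suc j) zero _ = trans (β.top _) (sym (α.top _)) , trans (β.top _) (sym (α.top _))
  cone (suc j) (suc i) (s≤s i+j<) = proj₂ here ,
    pos-cancel (α (suc i) j) (α.positive (suc i) (s≤s (ℕ.m≤n⇒m≤1+n i≤m)) j) (begin
      α (suc i) j * β (suc i) (2 ℕ.+ j) ≡⟨ cong (_* _) (proj₁ here) ⟨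
      β (suc i) j * β (suc i) (2 ℕ.+ j) ≡⟨ β.rule i (ℕ.≤-<-trans i≤m m<n) j ⟩
      β (suc i) (suc j) + β i (suc j) * β (2 ℕ.+ i) (suc j)
        ≡⟨ cong₂ _+_ (proj₂ here) (cong₂ _*_ (proj₂ above) (proj₂ below)) ⟩
      α (suc i) (suc j) + α i (suc j) * α (2 ℕ.+ i) (suc j) ≡⟨ α.rule i (s≤s i≤m) j ⟨
      α (suc i) j * α (suc i) (2 ℕ.+ j) ∎)
    where
    open ≡-Reasoning
    i+1+j≤m : suc (i ℕ.+ j) ℕ.≤ m
    i+1+j≤m = subst (ℕ._≤ m) (ℕ.+-suc i j) i+j<
    i≤m : i ℕ.≤ m
    i≤m = ℕ.≤-trans (ℕ.m≤m+n i j) (ℕ.<⇒≤ i+1+j≤m)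
    below = cone j (2 ℕ.+ i) (s≤s i+1+j≤m)
    here  = cone j (1 ℕ.+ i) (s≤s (ℕ.<⇒≤ i+1+j≤m))
    above = cone j i (ℕ.m≤n⇒m≤1+n (ℕ.<⇒≤ i+1+j≤m))

  cone-boundary : ∀ j i → i ℕ.+ j ≡ m →
    α (suc m) 0 * (β (suc i) (2 ℕ.+ j) - α (suc i) (2 ℕ.+ j)) ≡ (β (2 ℕ.+ m) 1 - 1ℤ) * α i (suc j)
  -- In this row, the last non-trivial one of `α`, the two rules differ only in the entry below: 1
  -- for `α` and `β (2 + i) 1` for `β`.
  cone-boundary zero i i+0≡m with refl ← trans (sym (ℕ.+-identityʳ i)) i+0≡m = begin
    α (suc i) 0 * (β (suc i) 2 - α (suc i) 2)               ≡⟨ expand (α (suc i) 0) _ _ ⟩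
    α (suc i) 0 * β (suc i) 2 - α (suc i) 0 * α (suc i) 2
      ≡⟨ cong₂ (λ s t → s * β (suc i) 2 - t) (sym (agree₀ (suc i) ℕ.≤-refl)) (α.rule i ℕ.≤-refl 0) ⟩
    β (suc i) 0 * β (suc i) 2 - (α (suc i) 1 + α i 1 * α (2 ℕ.+ i) 1)
      ≡⟨ cong₂ _-_ (β.rule i m<n 0) (cong (λ t → α (suc i) 1 + α i 1 * t) (α.bottom 1)) ⟩
    β (suc i) 1 + β i 1 * β (2 ℕ.+ i) 1 - (α (suc i) 1 + α i 1 * 1ℤ)
      ≡⟨ cong₂ (λ s t → s + t * β (2 ℕ.+ i) 1 - (α (suc i) 1 + α i 1 * 1ℤ))
           (agree₁ (suc i) ℕ.≤-refl) (agree₁ i (ℕ.n≤1+n i)) ⟩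
    α (suc i) 1 + α i 1 * β (2 ℕ.+ i) 1 - (α (suc i) 1 + α i 1 * 1ℤ)
      ≡⟨ collect (α (suc i) 1) (α i 1) _ ⟩
    (β (2 ℕ.+ i) 1 - 1ℤ) * α i 1                            ∎
    where
    open ≡-Reasoning
    expand : ∀ x p q → x * (p - q) ≡ x * p - x * q
    expand = solve-∀
    collect : ∀ p q v → p + q * v - (p + q * 1ℤ) ≡ (v - 1ℤ) * q
    collect = solve-∀
  -- The difference of the two rules is `q` times the difference one row down and one column back.
  -- The induction turns the latter into a multiple of `p`, which cancels.
  cone-boundary (suc j) i i+1+j≡m = pos-cancel p (α.positive (suc i) (s≤s (ℕ.m≤n⇒m≤1+n i≤m)) (suc j)) (begin
      p * (x * (β (suc i) (3 ℕ.+ j) - α (suc i) (3 ℕ.+ j))) ≡⟨ expand x p _ _ ⟩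
      x * (p * β (suc i) (3 ℕ.+ j) - p * α (suc i) (3 ℕ.+ j))
        ≡⟨ cong (x *_) (cong₂ _-_
             (trans (cong (_* _) (sym (proj₁ here))) (β.rule i (ℕ.≤-<-trans i≤m m<n) (suc j)))
             (α.rule i (s≤s i≤m) (suc j))) ⟩
      x * (β (suc i) (2 ℕ.+ j) + β i (2 ℕ.+ j) * β (2 ℕ.+ i) (2 ℕ.+ j) - (s + q * α (2 ℕ.+ i) (2 ℕ.+ j)))
        ≡⟨ cong₂ (λ s′ q′ → x * (s′ + q′ * β (2 ℕ.+ i) (2 ℕ.+ j) - (s + q * α (2 ℕ.+ i) (2 ℕ.+ j))))
             (proj₂ here) (proj₂ above) ⟩
      x * (s + q * β (2 ℕ.+ i) (2 ℕ.+ j) - (s + q * α (2 ℕ.+ i) (2 ℕ.+ j)))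
        ≡⟨ collect x s q _ _ ⟩
      q * (x * (β (2 ℕ.+ i) (2 ℕ.+ j) - α (2 ℕ.+ i) (2 ℕ.+ j)))
        ≡⟨ cong (q *_) (cone-boundary j (suc i) 1+i+j≡m) ⟩
      q * ((β (2 ℕ.+ m) 1 - 1ℤ) * p)  ≡⟨ rotate q (β (2 ℕ.+ m) 1 - 1ℤ) p ⟩
      p * ((β (2 ℕ.+ m) 1 - 1ℤ) * q)  ∎)
    where
    open ≡-Reasoning
    x = α (suc m) 0
    p = α (suc i) (suc j)
    q = α i (2 ℕ.+ j)
    s = α (suc i) (2 ℕ.+ j)
    1+i+j≡m : suc (i ℕ.+ j) ≡ m
    1+i+j≡m = trans (sym (ℕ.+-suc i j)) i+1+j≡m
    i≤m : i ℕ.≤ m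
    i≤m = subst (i ℕ.≤_) i+1+j≡m (ℕ.m≤m+n i (suc j))
    here  = cone (suc j) (suc i) (s≤s (ℕ.≤-reflexive i+1+j≡m))
    above = cone (suc j) i (ℕ.m≤n⇒m≤1+n (ℕ.≤-reflexive i+1+j≡m))
    expand : ∀ x p b a → p * (x * (b - a)) ≡ x * (p * b - p * a)
    expand = solve-∀
    collect : ∀ x s q b a → x * (s + q * b - (s + q * a)) ≡ q * (x * (b - a))
    collect = solve-∀
    rotate : ∀ q v p → q * (v * p) ≡ p * (v * q)
    rotate = solve-∀

  cone-congruence : β (2 ℕ.+ m) 1 ≡ 1ℤ [mod α (suc m) 0 ]
  cone-congruence = divides (β 1 (2 ℕ.+ m) - α 1 (2 ℕ.+ m)) (begin
    β (2 ℕ.+ m) 1 - 1ℤ                  ≡⟨ *-identityʳ _ ⟨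
    (β (2 ℕ.+ m) 1 - 1ℤ) * 1ℤ           ≡⟨ cong ((β (2 ℕ.+ m) 1 - 1ℤ) *_) (α.top (suc m)) ⟨
    (β (2 ℕ.+ m) 1 - 1ℤ) * α 0 (suc m)  ≡⟨ cone-boundary m 0 refl ⟨
    α (suc m) 0 * (β 1 (2 ℕ.+ m) - α 1 (2 ℕ.+ m)) ≡⟨ *-comm (α (suc m) 0) _ ⟩
    (β 1 (2 ℕ.+ m) - α 1 (2 ℕ.+ m)) * α (suc m) 0 ∎)
    where open ≡-Reasoning

-- Divisibility from the rule in the outer rows.

last-row-divides : ∀ {m α} → IsClosedRay (suc m) α → α (suc m) 0 ∣ α (suc m) 1 + α m 1
last-row-divides {m} {α} ray = divides (α (suc m) 2) (begin
  α (suc m) 1 + α m 1                 ≡⟨ cong (λ t → α (suc m) 1 + t) (*-identityʳ (α m 1)) ⟨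
  α (suc m) 1 + α m 1 * 1ℤ            ≡⟨ cong (λ t → α (suc m) 1 + α m 1 * t) (bottom 1) ⟨
  α (suc m) 1 + α m 1 * α (2 ℕ.+ m) 1 ≡⟨ rule m ℕ.≤-refl 0 ⟨
  α (suc m) 0 * α (suc m) 2           ≡⟨ *-comm (α (suc m) 0) _ ⟩
  α (suc m) 2 * α (suc m) 0           ∎)
  where open ≡-Reasoning; open IsClosedRay ray

first-row-divides : ∀ {ℓ β} → 1 ℕ.≤ ℓ → IsClosedRay ℓ β → β 1 0 ∣ β 1 1 + β 2 1
first-row-divides {ℓ} {β} 1≤ℓ ray = divides (β 1 2) (begin
  β 1 1 + β 2 1         ≡⟨ cong (λ t → β 1 1 + t) (*-identityˡ (β 2 1)) ⟨
  β 1 1 + 1ℤ * β 2 1    ≡⟨ cong (λ t → β 1 1 + t * β 2 1) (top 1) ⟨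
  β 1 1 + β 0 1 * β 2 1 ≡⟨ rule 0 1≤ℓ 0 ⟨
  β 1 0 * β 1 2         ≡⟨ *-comm (β 1 0) _ ⟩
  β 1 2 * β 1 0         ∎)
  where open ≡-Reasoning; open IsClosedRay ray

-- Representation of a ray by a fan, and its period.

-- The entry of row r in the array of a fan L is L i ∙ L j with j = gap r + i.
gap : ℕ → ℕ
gap zero    = 3
gap (suc r) = 2 ℕ.+ gap r

gap-≡ : ∀ r → gap r ≡ 3 ℕ.+ (r ℕ.+ r)
gap-≡ zero    = refl
gap-≡ (suc r) = trans (cong (2 ℕ.+_) (gap-≡ r)) (cong (4 ℕ.+_) (sym (ℕ.+-suc r r)))

shift₁ : ∀ n i → 1 ℕ.+ (n ℕ.+ i) ≡ n ℕ.+ (1 ℕ.+ i)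
shift₁ n i = sym (ℕ.+-suc n i)

shift₂ : ∀ n i → 2 ℕ.+ (n ℕ.+ i) ≡ n ℕ.+ (2 ℕ.+ i)
shift₂ n i = trans (cong suc (shift₁ n i)) (shift₁ n (suc i))

pairing-rule : ∀ (L₀ L₁ L₂ M₀ M₁ M₂ : ℤ³) → L₀ ⨯ L₂ ≡ L₁ → M₀ ⨯ M₂ ≡ M₁ →
               L₁ ∙ M₁ ≡ (L₀ ∙ M₀) * (L₂ ∙ M₂) - (L₀ ∙ M₂) * (L₂ ∙ M₀)
pairing-rule L₀ _ L₂ M₀ _ M₂ refl refl = binet-cauchy L₀ L₂ M₀ M₂

module Representation {m α} (ray : IsPositiveRay m α) {L : ℕ → ℤ³} (fan : Fan L)
                      (first-row : ∀ k → L k ∙ L (5 ℕ.+ k) ≡ α 1 (suc k)) where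
  open IsPositiveRay ray
  open Fan fan

  private
    rule-at : ∀ i j → (L (2 ℕ.+ i) ∙ L j) * (L i ∙ L (2 ℕ.+ j)) ≡
              (L i ∙ L j) * (L (2 ℕ.+ i) ∙ L (2 ℕ.+ j)) - L (1 ℕ.+ i) ∙ L (1 ℕ.+ j)
    rule-at i j = begin
      r * p            ≡⟨ cancel p q r ⟩
      q - (q - p * r)  ≡⟨ cong (λ t → q - t)
        (pairing-rule (L i) (L (1 ℕ.+ i)) (L (2 ℕ.+ i)) (L j) (L (1 ℕ.+ j)) (L (2 ℕ.+ j)) (cross i) (cross j)) ⟨
      q - L (1 ℕ.+ i) ∙ L (1 ℕ.+ j) ∎
      where
      open ≡-Reasoning
      p = L i ∙ L (2 ℕ.+ j)
      q = (L i ∙ L j) * (L (2 ℕ.+ i) ∙ L (2 ℕ.+ j))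
      r = L (2 ℕ.+ i) ∙ L j
      cancel : ∀ p q r → r * p ≡ q - (q - p * r)
      cancel = solve-∀

  -- The fan and `α` both express the product of rows `r` and `2 + r` through row `1 + r`, and the
  -- positive entry in row `r` cancels. The indices come with equations, so that sums in any
  -- arrangement can be passed.
  entry : ∀ r → r ℕ.≤ suc m → ∀ {i j k} → j ≡ gap r ℕ.+ i → k ≡ r ℕ.+ i → L i ∙ L j ≡ α r k
  entry zero          _   {i} refl refl = trans (unit i) (sym (top i))
  entry (suc zero)    _   {i} refl refl = first-row i
  entry (suc (suc r)) (s≤s r<m) {i} refl refl =
    pos-cancel (α r (2 ℕ.+ r ℕ.+ i)) (positive r (ℕ.m≤n⇒m≤1+n (ℕ.<⇒≤ r<m)) _) (begin
      α r k * (L i ∙ L (2 ℕ.+ j))                      ≡⟨ cong (_* (L i ∙ L (2 ℕ.+ j))) above ⟨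
      (L (2 ℕ.+ i) ∙ L j) * (L i ∙ L (2 ℕ.+ j))        ≡⟨ rule-at i j ⟩
      (L i ∙ L j) * (L (2 ℕ.+ i) ∙ L (2 ℕ.+ j)) - (L (1 ℕ.+ i) ∙ L (1 ℕ.+ j))
        ≡⟨ cong₂ _-_ (cong₂ _*_ (entry (suc r) r+1≤ refl refl)
             (entry (suc r) r+1≤ (shift₂ (gap (suc r)) i) (shift₂ (suc r) i)))
             (entry (suc r) r+1≤ (shift₁ (gap (suc r)) i) (shift₁ (suc r) i)) ⟩
      α (suc r) (suc r ℕ.+ i) * α (suc r) (3 ℕ.+ r ℕ.+ i) - α (suc r) k
        ≡⟨ cong (_- α (suc r) k) (rule r r<m (suc r ℕ.+ i)) ⟩
      α (suc r) k + α r k * α (2 ℕ.+ r) k - α (suc r) k ≡⟨ collect (α (suc r) k) _ ⟩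
      α r k * α (2 ℕ.+ r) k                            ∎)
    where
    open ≡-Reasoning
    k = 2 ℕ.+ r ℕ.+ i
    j = gap (suc r) ℕ.+ i
    r+1≤ : suc r ℕ.≤ suc m
    r+1≤ = ℕ.m≤n⇒m≤1+n r<m
    above : L (2 ℕ.+ i) ∙ L j ≡ α r k
    above = entry r (ℕ.m≤n⇒m≤1+n (ℕ.<⇒≤ r<m)) (shift₂ (gap r) i) (shift₂ r i)
    collect : ∀ p q → p + q - p ≡ q
    collect = solve-∀

  last : ∀ {i j} → j ≡ gap (suc m) ℕ.+ i → L i ∙ L j ≡ 1ℤ
  last {i} j≡ = trans (entry (suc m) ℕ.≤-refl j≡ refl) (bottom _)

  -- One row beyond the bottom: the rule in the row of ones reads 1 = 1 · 1 - 0, as the other factor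
  -- of the last product is a positive entry of row `m`.
  vanish₁ : ∀ i → L i ∙ L (gap (2 ℕ.+ m) ℕ.+ i) ≡ 0ℤ
  vanish₁ i = pos-cancel (α m (2 ℕ.+ m ℕ.+ i)) (positive m (ℕ.n≤1+n m) _) (begin
    α m (2 ℕ.+ m ℕ.+ i) * (L i ∙ L (2 ℕ.+ j))
      ≡⟨ cong (_* (L i ∙ L (2 ℕ.+ j))) (entry m (ℕ.n≤1+n m) (shift₂ (gap m) i) (shift₂ m i)) ⟨
    (L (2 ℕ.+ i) ∙ L j) * (L i ∙ L (2 ℕ.+ j))                                ≡⟨ rule-at i j ⟩
    (L i ∙ L j) * (L (2 ℕ.+ i) ∙ L (2 ℕ.+ j)) - L (1 ℕ.+ i) ∙ L (1 ℕ.+ j)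
      ≡⟨ cong₂ _-_ (cong₂ _*_ (last refl) (last (shift₂ (gap (suc m)) i))) (last (shift₁ (gap (suc m)) i)) ⟩
    0ℤ                                                                       ≡⟨ *-zeroʳ (α m (2 ℕ.+ m ℕ.+ i)) ⟨
    α m (2 ℕ.+ m ℕ.+ i) * 0ℤ                                                 ∎)
    where
    open ≡-Reasoning
    j = gap (suc m) ℕ.+ i

  -- Two rows beyond the bottom: in the rule in the row of zeros, the factor from the row above is
  -- 1.
  vanish₂ : ∀ i → L i ∙ L (gap (3 ℕ.+ m) ℕ.+ i) ≡ 0ℤ
  vanish₂ i = begin
    L i ∙ L (2 ℕ.+ j)                                                        ≡⟨ *-identityˡ _ ⟨
    1ℤ * (L i ∙ L (2 ℕ.+ j))
      ≡⟨ cong (_* (L i ∙ L (2 ℕ.+ j))) (last (shift₂ (gap (suc m)) i)) ⟨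
    (L (2 ℕ.+ i) ∙ L j) * (L i ∙ L (2 ℕ.+ j))                                ≡⟨ rule-at i j ⟩
    (L i ∙ L j) * (L (2 ℕ.+ i) ∙ L (2 ℕ.+ j)) - L (1 ℕ.+ i) ∙ L (1 ℕ.+ j)
      ≡⟨ cong₂ (λ s t → s * (L (2 ℕ.+ i) ∙ L (2 ℕ.+ j)) - t) (vanish₁ i)
           (trans (cong (λ n → L (1 ℕ.+ i) ∙ L n) (shift₁ (gap (2 ℕ.+ m)) i)) (vanish₁ (suc i))) ⟩
    0ℤ * (L (2 ℕ.+ i) ∙ L (2 ℕ.+ j)) - 0ℤ                                    ≡⟨ +-identityʳ _ ⟩
    0ℤ * (L (2 ℕ.+ i) ∙ L (2 ℕ.+ j))                                         ≡⟨ *-zeroˡ (L (2 ℕ.+ i) ∙ L (2 ℕ.+ j)) ⟩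
    0ℤ                                                                       ∎
    where
    open ≡-Reasoning
    j = gap (2 ℕ.+ m) ℕ.+ i

  -- The shift is 2 m + 8. For `suc k`, the rows beyond the bottom give the shifted vector the
  -- products 0, 0, 1 with `L k`, `L (2 + k)`, `L (4 + k)`, which are also those of `L (1 + k)`.
  period : ∀ k → L (gap (2 ℕ.+ m) ℕ.+ (1 ℕ.+ k)) ≡ L k
  -- No vector precedes `L 0` to test against, so `period 1` and the cross products are used
  -- instead.
  period zero = begin
    L (gap (2 ℕ.+ m) ℕ.+ 1)                     ≡⟨ cong L (shift₁ (gap (2 ℕ.+ m)) 0) ⟨
    L (1 ℕ.+ g)                                 ≡⟨ cross g ⟨
    L g ⨯ L (2 ℕ.+ g)                           ≡⟨ cong (λ n → L g ⨯ L n) (shift₂ (gap (2 ℕ.+ m)) 0) ⟩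
    L g ⨯ L (gap (2 ℕ.+ m) ℕ.+ 2)               ≡⟨ cong (L g ⨯_) (period 1) ⟩
    L g ⨯ L 1                                   ≡⟨ cong (L g ⨯_) (cross 0) ⟨
    L g ⨯ (L 0 ⨯ L 2)                           ≡⟨ ⨯-⨯ (L g) (L 0) (L 2)
      (trans (∙-comm (L g) (L 0)) (vanish₁ 0))
      (trans (∙-comm (L g) (L 2)) (last (shift₂ (gap (suc m)) 0))) ⟩
    L 0                                         ∎
    where
    open ≡-Reasoning
    g = gap (2 ℕ.+ m) ℕ.+ 0
  period (suc k) = ∙-injective-frame frame-unimodular
    (begin
      L (gap (2 ℕ.+ m) ℕ.+ (2 ℕ.+ k)) ∙ L k   ≡⟨ ∙-comm _ (L k) ⟩
      L k ∙ L (gap (2 ℕ.+ m) ℕ.+ (2 ℕ.+ k))   ≡⟨ cong (λ n → L k ∙ L n) (shift₂ (gap (2 ℕ.+ m)) k) ⟨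
      L k ∙ L (gap (3 ℕ.+ m) ℕ.+ k)           ≡⟨ vanish₂ k ⟩
      0ℤ                                      ≡⟨ ∙-⨯ˡ (L k) (L (2 ℕ.+ k)) ⟨
      L k ∙ (L k ⨯ L (2 ℕ.+ k))               ≡⟨ cong (L k ∙_) (cross k) ⟩
      L k ∙ L (1 ℕ.+ k)                       ≡⟨ ∙-comm (L k) _ ⟩
      L (1 ℕ.+ k) ∙ L k                       ∎)
    (begin
      L (gap (2 ℕ.+ m) ℕ.+ (2 ℕ.+ k)) ∙ L (2 ℕ.+ k)   ≡⟨ ∙-comm _ (L (2 ℕ.+ k)) ⟩
      L (2 ℕ.+ k) ∙ L (gap (2 ℕ.+ m) ℕ.+ (2 ℕ.+ k))   ≡⟨ vanish₁ (2 ℕ.+ k) ⟩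
      0ℤ                                              ≡⟨ ∙-⨯ʳ (L k) (L (2 ℕ.+ k)) ⟨
      L (2 ℕ.+ k) ∙ (L k ⨯ L (2 ℕ.+ k))               ≡⟨ cong (L (2 ℕ.+ k) ∙_) (cross k) ⟩
      L (2 ℕ.+ k) ∙ L (1 ℕ.+ k)                       ≡⟨ ∙-comm (L (2 ℕ.+ k)) _ ⟩
      L (1 ℕ.+ k) ∙ L (2 ℕ.+ k)                       ∎)
    (begin
      L (gap (2 ℕ.+ m) ℕ.+ (2 ℕ.+ k)) ∙ L (4 ℕ.+ k)   ≡⟨ ∙-comm _ (L (4 ℕ.+ k)) ⟩
      L (4 ℕ.+ k) ∙ L (gap (2 ℕ.+ m) ℕ.+ (2 ℕ.+ k))   ≡⟨ last (shift₂ (gap (suc m)) (2 ℕ.+ k)) ⟩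
      1ℤ                                              ≡⟨ unit (suc k) ⟨
      L (1 ℕ.+ k) ∙ L (4 ℕ.+ k)                       ∎)
    where
    open ≡-Reasoning
    frame-unimodular : det (L k) (L (2 ℕ.+ k)) (L (4 ℕ.+ k)) ≡ 1ℤ
    frame-unimodular = trans (cong (L k ∙_) (cross (2 ℕ.+ k))) (unit k)

-- Periodic sequences and their arrays

-- A positive `q` would force `i` to be at least `N`; a negative one is the same case with `i` and
-- `j` exchanged.
residue-unique : ∀ {N i j} q → i ℕ.< N → j ℕ.< N → + i ≡ + j + q * + N → i ≡ j
residue-unique {N} {i} {j} (+ zero) _ _ eq = +-injective (trans eq (+-identityʳ (+ j)))
residue-unique {N} {i} {j} (+ suc q) i<N _ eq = ⊥-elim (ℕ.<⇒≱ i<N (begin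
  N                    ≤⟨ ℕ.m≤m+n N (q ℕ.* N) ⟩
  suc q ℕ.* N          ≤⟨ ℕ.m≤n+m (suc q ℕ.* N) j ⟩
  j ℕ.+ suc q ℕ.* N    ≡⟨ +-injective (trans eq (cong (λ t → + j + t) (sym (pos-* (suc q) N)))) ⟨
  i                    ∎))
  where open ℕ.≤-Reasoning
residue-unique {N} {i} {j} -[1+ q ] i<N j<N eq =
  sym (residue-unique (+ suc q) j<N i<N (trans (cancel (+ j) (-[1+ q ]) (+ N)) (cong (_+ (+ suc q) * + N) (sym eq))))
  where
  cancel : ∀ j q N → j ≡ j + q * N + (- q) * N
  cancel = solve-∀

-- Two overlaps suffice for relations among three consecutive terms: a triple that starts below `N`
-- ends at `N + 1` at the latest.
module PeriodicExtension {A : Set} (N : ℕ) .{{_ : ℕ.NonZero N}} (U : ℕ → A)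
                         (wrap₀ : U N ≡ U 0) (wrap₁ : U (suc N) ≡ U 1) where

  opaque
    W : ℤ → A
    W k = U (k %ℕ N)

    W-residue : ∀ k → W k ≡ U (k %ℕ N)
    W-residue k = refl

  private
    W-below : ∀ {k j} q → j ℕ.< N → k ≡ + j + q * + N → W k ≡ U j
    W-below {k} {j} q j<N eq = trans (W-residue k) (cong U (residue-unique (q - k /ℕ N) (n%ℕd<d k N) j<N
      (trans (isolate (+ (k %ℕ N)) (k /ℕ N) (+ N))
        (trans (cong (_- (k /ℕ N) * + N) (trans (sym (a≡a%ℕn+[a/ℕn]*n k N)) eq))
          (collect (+ j) q (k /ℕ N) (+ N))))))
      where
      isolate : ∀ r p n → r ≡ r + p * n - p * n
      isolate = solve-∀
      collect : ∀ j q p n → j + q * n - p * n ≡ j + (q - p) * n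
      collect = solve-∀

    W-wrap : ∀ {k j} q i → j ≡ N ℕ.+ i → k ≡ + j + q * + N → k ≡ + i + (1ℤ + q) * + N
    W-wrap q i refl eq = trans eq (lemma q (+ i) (+ N))
      where
      lemma : ∀ q i n → n + i + q * n ≡ i + (1ℤ + q) * n
      lemma = solve-∀

  W≡U : ∀ {k j} q → j ℕ.≤ suc N → k ≡ + j + q * + N → W k ≡ U j
  W≡U {k} {j} q j≤1+N eq with ℕ.m≤n⇒m<n∨m≡n j≤1+N
  ... | inj₁ (s≤s j≤N) with ℕ.m≤n⇒m<n∨m≡n j≤N
  ...   | inj₁ j<N  = W-below q j<N eq
  ...   | inj₂ refl = trans (W-below (1ℤ + q) (ℕ.>-nonZero⁻¹ N) (W-wrap q 0 (sym (ℕ.+-identityʳ N)) eq)) (sym wrap₀)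
  W≡U {k} {j} q j≤1+N eq | inj₂ refl = trans (one (W-wrap q 1 (sym (ℕ.+-comm N 1)) eq)) (sym wrap₁)
    where
    one : k ≡ 1ℤ + (1ℤ + q) * + N → W k ≡ U 1
    one eq with ℕ.m≤n⇒m<n∨m≡n (ℕ.>-nonZero⁻¹ N)
    ... | inj₁ 1<N  = W-below (1ℤ + q) 1<N eq
    -- Here `N` is 1, so index 1 wraps around once more.
    ... | inj₂ refl = trans (W-below (1ℤ + (1ℤ + q)) (s≤s z≤n) (W-wrap (1ℤ + q) 0 refl eq)) (sym wrap₀)

  period : ∀ k → W (k + + N) ≡ W k
  period k = trans
    (W-below (1ℤ + k /ℕ N) (n%ℕd<d k N)
      (trans (cong (_+ + N) (a≡a%ℕn+[a/ℕn]*n k N)) (collect (+ (k %ℕ N)) (k /ℕ N) (+ N))))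
    (sym (W-residue k))
    where
    collect : ∀ r p n → r + p * n + n ≡ r + (1ℤ + p) * n
    collect = solve-∀

  consecutive : (P : A → A → A → Set) → (∀ j → j ℕ.< N → P (U j) (U (1 ℕ.+ j)) (U (2 ℕ.+ j))) →
                ∀ k → P (W k) (W (1ℤ + k)) (W (+ 2 + k))
  consecutive P holds k = subst (λ X → P X (W (1ℤ + k)) (W (+ 2 + k))) (sym (W-residue k))
    (subst₂ (P (U j)) (sym (W≡U q (s≤s (ℕ.<⇒≤ j<N)) (next 1ℤ))) (sym (W≡U q (s≤s j<N) (next (+ 2)))) (holds j j<N))
    where
    q = k /ℕ N
    j = k %ℕ N
    j<N = n%ℕd<d k N
    next : ∀ i → i + k ≡ i + + j + q * + N
    next i = trans (cong (λ t → i + t) (a≡a%ℕn+[a/ℕn]*n k N)) (sym (+-assoc i (+ j) (q * + N)))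

glue : {A : Set} → ℕ → (ℕ → A) → (ℕ → A) → ℕ → A
glue zero    f g j       = g j
glue (suc n) f g zero    = f 0
glue (suc n) f g (suc j) = glue n (λ i → f (suc i)) g j

module _ {A : Set} {g : ℕ → A} where

  glue-right : ∀ n f i → glue n f g (n ℕ.+ i) ≡ g i
  glue-right zero    f i = refl
  glue-right (suc n) f i = glue-right n _ i

  glue-left : ∀ n {f} → f n ≡ g 0 → f (suc n) ≡ g 1 → ∀ j → j ℕ.≤ suc n → glue n f g j ≡ f j
  glue-left zero    eq₀ eq₁ zero          _ = sym eq₀
  glue-left zero    eq₀ eq₁ (suc zero)    _ = sym eq₁
  glue-left zero    eq₀ eq₁ (suc (suc j)) (s≤s ())
  glue-left (suc n) eq₀ eq₁ zero          _ = refl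
  glue-left (suc n) eq₀ eq₁ (suc j) (s≤s j≤) = glue-left n eq₀ eq₁ j j≤

  -- The sequences share two terms at the seam, so each triple lies wholly in one of them.
  glue-consecutive : (P : A → A → A → Set) → (∀ j → P (g j) (g (1 ℕ.+ j)) (g (2 ℕ.+ j))) →
                     ∀ n {f} → (∀ j → P (f j) (f (1 ℕ.+ j)) (f (2 ℕ.+ j))) → f n ≡ g 0 → f (suc n) ≡ g 1 →
                     ∀ j → P (glue n f g j) (glue n f g (1 ℕ.+ j)) (glue n f g (2 ℕ.+ j))
  glue-consecutive P Pg zero    Pf eq₀ eq₁ j       = Pg j
  glue-consecutive P Pg (suc n) Pf eq₀ eq₁ (suc j) = glue-consecutive P Pg n (λ i → Pf (suc i)) eq₀ eq₁ j
  glue-consecutive P Pg (suc n) Pf eq₀ eq₁ zero    =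
    subst₂ (P _) (sym (glue-left n eq₀ eq₁ 0 z≤n)) (sym (glue-left n eq₀ eq₁ 1 (s≤s z≤n))) (Pf 0)

-- P, Q, R, S are consecutive and Q = P ⨯ (Q ⨯ S) = (P ∙ S) Q.
cross⇒unit : ∀ P Q R S X → P ⨯ R ≡ Q → Q ⨯ S ≡ R → Q ∙ X ≡ 1ℤ → P ∙ S ≡ 1ℤ
cross⇒unit P Q R S X P⨯R≡Q Q⨯S≡R Q∙X≡1 = begin
  P ∙ S                                  ≡⟨ simplify (P ∙ S) (S ∙ X) ⟨
  (P ∙ S) * 1ℤ - 0ℤ * (S ∙ X)            ≡⟨ cong₂ (λ s t → (P ∙ S) * s - t * (S ∙ X)) Q∙X≡1 P∙Q≡0 ⟨
  (P ∙ S) * (Q ∙ X) - (P ∙ Q) * (S ∙ X)  ≡⟨ lagrange P Q S X ⟨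
  (P ⨯ (Q ⨯ S)) ∙ X                      ≡⟨ cong (λ Y → (P ⨯ Y) ∙ X) Q⨯S≡R ⟩
  (P ⨯ R) ∙ X                            ≡⟨ cong (_∙ X) P⨯R≡Q ⟩
  Q ∙ X                                  ≡⟨ Q∙X≡1 ⟩
  1ℤ                                     ∎
  where
  open ≡-Reasoning
  simplify : ∀ s t → s * 1ℤ - 0ℤ * t ≡ s
  simplify = solve-∀
  P∙Q≡0 : P ∙ Q ≡ 0ℤ
  P∙Q≡0 = trans (cong (P ∙_) (sym P⨯R≡Q)) (∙-⨯ˡ P R)

fanArray : (ℤ → ℤ³) → ℤ → Array
fanArray W s i c = W (c - + i + s) ∙ W (c + + 3 + + i + s)

module FanArray (W : ℤ → ℤ³) (s : ℤ)
                (cross : ∀ k → W k ⨯ W (+ 2 + k) ≡ W (1ℤ + k))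
                (unit : ∀ k → W k ∙ W (+ 3 + k) ≡ 1ℤ) where

  fan-rule : ∀ i c → fanArray W s (suc i) c ≡
    fanArray W s (suc i) (c - 1ℤ) * fanArray W s (suc i) (c + 1ℤ) - fanArray W s i c * fanArray W s (suc (suc i)) c
  fan-rule i c = trans
    (pairing-rule (W (c - 1ℤ - (1ℤ + + i) + s)) (W (c - (1ℤ + + i) + s)) (W (c + 1ℤ - (1ℤ + + i) + s))
                  (W (c - 1ℤ + + 3 + (1ℤ + + i) + s)) (W (c + + 3 + (1ℤ + + i) + s)) (W (c + 1ℤ + + 3 + (1ℤ + + i) + s))
      (cross-at (down₂ c (+ i) s) (down₁ c (+ i) s)) (cross-at (up₂ c (+ i) s) (up₁ c (+ i) s)))
    (cong (λ t → fanArray W s (suc i) (c - 1ℤ) * fanArray W s (suc i) (c + 1ℤ) - t)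
      (trans (*-comm (W (c - 1ℤ - (1ℤ + + i) + s) ∙ W (c + 1ℤ + + 3 + (1ℤ + + i) + s)) _)
        (cong₂ _*_
          (cong₂ (λ p q → W p ∙ W q) (corner₁ c (+ i) s) (corner₂ c (+ i) s))
          (cong₂ (λ p q → W p ∙ W q) (corner₃ c (+ i) s) (corner₄ c (+ i) s)))))
    where
    cross-at : ∀ {p q r} → r ≡ + 2 + p → q ≡ 1ℤ + p → W p ⨯ W r ≡ W q
    cross-at {p} refl refl = cross p
    down₁ : ∀ c i s → c - (1ℤ + i) + s ≡ 1ℤ + (c - 1ℤ - (1ℤ + i) + s)
    down₁ = solve-∀
    down₂ : ∀ c i s → c + 1ℤ - (1ℤ + i) + s ≡ + 2 + (c - 1ℤ - (1ℤ + i) + s)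
    down₂ = solve-∀
    up₁ : ∀ c i s → c + + 3 + (1ℤ + i) + s ≡ 1ℤ + (c - 1ℤ + + 3 + (1ℤ + i) + s)
    up₁ = solve-∀
    up₂ : ∀ c i s → c + 1ℤ + + 3 + (1ℤ + i) + s ≡ + 2 + (c - 1ℤ + + 3 + (1ℤ + i) + s)
    up₂ = solve-∀
    corner₁ : ∀ c i s → c + 1ℤ - (1ℤ + i) + s ≡ c - i + s
    corner₁ = solve-∀
    corner₂ : ∀ c i s → c - 1ℤ + + 3 + (1ℤ + i) + s ≡ c + + 3 + i + s
    corner₂ = solve-∀
    corner₃ : ∀ c i s → c - 1ℤ - (1ℤ + i) + s ≡ c - (1ℤ + (1ℤ + i)) + s
    corner₃ = solve-∀
    corner₄ : ∀ c i s → c + 1ℤ + + 3 + (1ℤ + i) + s ≡ c + + 3 + (1ℤ + (1ℤ + i)) + s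
    corner₄ = solve-∀

  fan-closed : ∀ n → (∀ k → W (k + (+ 2 * + n + + 8)) ≡ W k) → IsClosed2Frieze n (fanArray W s)
  fan-closed n period = record
    { top    = λ c → trans (cong (λ k → W (c - 0ℤ + s) ∙ W k) (top-index c s)) (unit (c - 0ℤ + s))
    -- The two indices differ by 2 n + 5, three less than the period; up to a period and
    -- commutativity this is `unit`.
    ; bottom = λ c → begin
        W (c - (1ℤ + + n) + s) ∙ W (c + + 3 + (1ℤ + + n) + s)
          ≡⟨ cong₂ (λ p q → W p ∙ W q) (bottom-index₁ c (+ n) s) (bottom-index₂ c (+ n) s) ⟩
        W (+ 3 + (c - (+ 4 + + n) + s)) ∙ W (c - (+ 4 + + n) + s + (+ 2 * + n + + 8))
          ≡⟨ cong (W (+ 3 + (c - (+ 4 + + n) + s)) ∙_) (period (c - (+ 4 + + n) + s)) ⟩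
        W (+ 3 + (c - (+ 4 + + n) + s)) ∙ W (c - (+ 4 + + n) + s)
          ≡⟨ ∙-comm (W (+ 3 + (c - (+ 4 + + n) + s))) _ ⟩
        W (c - (+ 4 + + n) + s) ∙ W (+ 3 + (c - (+ 4 + + n) + s))
          ≡⟨ unit (c - (+ 4 + + n) + s) ⟩
        1ℤ ∎
    ; rule   = λ i _ → fan-rule i
    }
    where
    open ≡-Reasoning
    top-index : ∀ c s → c + + 3 + 0ℤ + s ≡ + 3 + (c - 0ℤ + s)
    top-index = solve-∀
    bottom-index₁ : ∀ c n s → c - (1ℤ + n) + s ≡ + 3 + (c - (+ 4 + n) + s)
    bottom-index₁ = solve-∀
    bottom-index₂ : ∀ c n s → c + + 3 + (1ℤ + n) + s ≡ c - (+ 4 + n) + s + (+ 2 * n + + 8)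
    bottom-index₂ = solve-∀

-- The glued frieze

module Gluing (m ℓ : ℕ) {a b : Array}
              (a-integral : IsIntegralClosed2Frieze (suc m) a) (b-integral : IsIntegralClosed2Frieze ℓ b)
              (c d x y κ : ℤ)
              (x≡a : x ≡ a (suc m) c) (x≡b : x ≡ b 1 d)
              (y≡a : y ≡ a (suc m) (c + 1ℤ)) (y≡b : y ≡ b 1 (d + 1ℤ))
              (κ-equation : κ * (x * y) ≡ x + y + 1ℤ) where

  open ≡-Reasoning

  private
    M = suc m
    -- With this base column, the entries of row `M` in columns `c` and `c + 1` are the products
    -- that start at `A 4` and `A 5`.
    α = right a (c - + (4 ℕ.+ M))
    -- The offset is a full period of `B`: the entries of row 1 in columns `d` and `d + 1` pair the
    -- vectors around the end of the period with `B 4` and `B 5`.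
    β = right b (d - + (gap (2 ℕ.+ ℓ) ℕ.+ 1))
    α-ray = right-positive a-integral (c - + (4 ℕ.+ M))
    β-ray = right-positive b-integral (d - + (gap (2 ℕ.+ ℓ) ℕ.+ 1))

    cancel : ∀ c n i → c - n + (n + i) ≡ c + i
    cancel = solve-∀

    α-column : ∀ r {k} i → k ≡ 4 ℕ.+ M ℕ.+ i → α r k ≡ a r (c + + i)
    α-column r i refl = cong (a r) (cancel c (+ (4 ℕ.+ M)) (+ i))

    β-column : ∀ r {k} i → k ≡ gap (2 ℕ.+ ℓ) ℕ.+ 1 ℕ.+ i → β r k ≡ b r (d + + i)
    β-column r i refl = cong (b r) (cancel d (+ (gap (2 ℕ.+ ℓ) ℕ.+ 1)) (+ i))

    -- q, h, t are the vectors of index 0, 2, 4 in the sequence of b.  Neighbouring vectors of a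
    -- are e₃, q, then (after a gap) t, e₁; the equations h ∙ e₃ = h ∙ e₁ = h ∙ (t ⨯ q) = 1 which h
    -- has to satisfy determine κ.
    q h t : ℤ³
    q = ⟨ y , 1ℤ , 0ℤ ⟩
    h = ⟨ 1ℤ , κ , 1ℤ ⟩
    t = ⟨ 0ℤ , 1ℤ , x ⟩

    -- The determinant is `κ * (x * y) - x - y`; here the divisibility of `x + y + 1` by `x * y`
    -- enters.
    qht-unimodular : det q h t ≡ 1ℤ
    qht-unimodular = trans (det-gluing-frame x y κ) (trans (cong (λ s → s - x - y) κ-equation) (collect x y))
      where
      collect : ∀ x y → x + y + 1ℤ - x - y ≡ 1ℤ
      collect = solve-∀

    module FA = FanConstruction (frame e₁ e₂ e₃ det-e₁e₂e₃) (λ k → α 1 (suc k))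
    module FB = FanConstruction (frame q h t qht-unimodular) (λ k → β 1 (suc k))

    A B : ℕ → ℤ³
    A = FA.L
    B = FB.L

    module A = Fan FA.isFan
    module B = Fan FB.isFan
    module RA = Representation α-ray FA.isFan FA.L∙L-5+
    module RB = Representation β-ray FB.isFan FB.L∙L-5+

    A4≡e₃ : A 4 ≡ e₃
    A4≡e₃ = FA.L-4+ 0

    -- The products with `A 0`, `A 2`, `A 4`, the standard basis, are an entry of row `M`, 1 by
    -- `unit` and 0 by `cross`. `A-end≡t`, `B5≡e₁` and `B-end≡e₃` are found likewise, those for `B`
    -- in the frame `q`, `h`, `t`.
    A5≡q : A 5 ≡ q
    A5≡q = ∙-injective-frame {e₁} {e₂} {e₃} det-e₁e₂e₃
      (begin
        A 5 ∙ e₁                                ≡⟨ cong (A 5 ∙_) (trans (RA.period 0) FA.L-0) ⟨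
        A 5 ∙ A (gap (2 ℕ.+ M) ℕ.+ 1)           ≡⟨ RA.entry M (ℕ.n≤1+n M) (shift₄ (gap M) 1) refl ⟩
        α M (M ℕ.+ 5)                           ≡⟨ α-column M 1 (index M) ⟩
        a M (c + 1ℤ)                            ≡⟨ y≡a ⟨
        y                                       ≡⟨ ∙-e₁ y 1ℤ 0ℤ ⟨
        q ∙ e₁                                  ∎)
      (begin
        A 5 ∙ e₂   ≡⟨ cong (A 5 ∙_) (FA.L-2+ 0) ⟨
        A 5 ∙ A 2  ≡⟨ ∙-comm (A 5) (A 2) ⟩
        A 2 ∙ A 5  ≡⟨ A.unit 2 ⟩
        1ℤ         ≡⟨ ∙-e₂ y 1ℤ 0ℤ ⟨
        q ∙ e₂     ∎)
      (begin
        A 5 ∙ e₃          ≡⟨ cong (A 5 ∙_) A4≡e₃ ⟨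
        A 5 ∙ A 4         ≡⟨ ∙-comm (A 5) (A 4) ⟩
        A 4 ∙ A 5         ≡⟨ cong (A 4 ∙_) (A.cross 4) ⟨
        A 4 ∙ (A 4 ⨯ A 6) ≡⟨ ∙-⨯ˡ (A 4) (A 6) ⟩
        0ℤ                ≡⟨ ∙-e₃ y 1ℤ 0ℤ ⟨
        q ∙ e₃            ∎)
      where
      shift₄ : ∀ n i → 4 ℕ.+ n ℕ.+ i ≡ n ℕ.+ (4 ℕ.+ i)
      shift₄ = ℕ-Solver.solve-∀
      index : ∀ n → n ℕ.+ 5 ≡ 4 ℕ.+ n ℕ.+ 1
      index = ℕ-Solver.solve-∀

    A-end≡t : A (gap (2 ℕ.+ M)) ≡ t
    A-end≡t = ∙-injective-frame {e₁} {e₂} {e₃} det-e₁e₂e₃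
      (begin
        A g ∙ e₁   ≡⟨ cong (A g ∙_) FA.L-0 ⟨
        A g ∙ A 0  ≡⟨ ∙-comm (A g) (A 0) ⟩
        A 0 ∙ A g  ≡⟨ cong (λ n → A 0 ∙ A n) (ℕ.+-identityʳ g) ⟨
        A 0 ∙ A (g ℕ.+ 0)  ≡⟨ RA.vanish₁ 0 ⟩
        0ℤ         ≡⟨ ∙-e₁ 0ℤ 1ℤ x ⟨
        t ∙ e₁     ∎)
      (begin
        A g ∙ e₂   ≡⟨ cong (A g ∙_) (FA.L-2+ 0) ⟨
        A g ∙ A 2  ≡⟨ ∙-comm (A g) (A 2) ⟩
        A 2 ∙ A g  ≡⟨ RA.last (ℕ.+-comm 2 (gap (suc M))) ⟩
        1ℤ         ≡⟨ ∙-e₂ 0ℤ 1ℤ x ⟨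
        t ∙ e₂     ∎)
      (begin
        A g ∙ e₃        ≡⟨ cong (A g ∙_) A4≡e₃ ⟨
        A g ∙ A 4       ≡⟨ ∙-comm (A g) (A 4) ⟩
        A 4 ∙ A g       ≡⟨ RA.entry M (ℕ.n≤1+n M) (ℕ.+-comm 4 (gap M)) refl ⟩
        α M (M ℕ.+ 4)   ≡⟨ α-column M 0 (index M) ⟩
        a M (c + 0ℤ)    ≡⟨ cong (a M) (+-identityʳ c) ⟩
        a M c           ≡⟨ x≡a ⟨
        x               ≡⟨ ∙-e₃ 0ℤ 1ℤ x ⟨
        t ∙ e₃          ∎)
      where
      g = gap (2 ℕ.+ M)
      index : ∀ n → n ℕ.+ 4 ≡ 4 ℕ.+ n ℕ.+ 0
      index = ℕ-Solver.solve-∀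

    A-end′≡e₁ : A (suc (gap (2 ℕ.+ M))) ≡ e₁
    A-end′≡e₁ = trans (cong A (ℕ.+-comm 1 (gap (2 ℕ.+ M)))) (trans (RA.period 0) FA.L-0)

    B4≡t : B 4 ≡ t
    B4≡t = FB.L-4+ 0

    B5≡e₁ : B 5 ≡ e₁
    B5≡e₁ = ∙-injective-frame qht-unimodular
      (begin
        B 5 ∙ q                                            ≡⟨ cong₂ _∙_ (RB.period 5) (trans (RB.period 0) FB.L-0) ⟨
        B (g ℕ.+ 6) ∙ B (g ℕ.+ 1)                          ≡⟨ ∙-comm (B (g ℕ.+ 6)) _ ⟩
        B (g ℕ.+ 1) ∙ B (g ℕ.+ 6)                          ≡⟨ RB.entry 1 (s≤s z≤n) (index g) refl ⟩
        β 1 (1 ℕ.+ (g ℕ.+ 1))                              ≡⟨ β-column 1 1 (ℕ.+-comm 1 (g ℕ.+ 1)) ⟩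
        b 1 (d + 1ℤ)                                       ≡⟨ y≡b ⟨
        y                                                  ≡⟨ value y ⟨
        e₁ ∙ q                                             ∎)
      (begin
        B 5 ∙ h    ≡⟨ cong (B 5 ∙_) (FB.L-2+ 0) ⟨
        B 5 ∙ B 2  ≡⟨ ∙-comm (B 5) (B 2) ⟩
        B 2 ∙ B 5  ≡⟨ B.unit 2 ⟩
        1ℤ         ≡⟨ trans (∙-comm e₁ h) (∙-e₁ 1ℤ κ 1ℤ) ⟨
        e₁ ∙ h     ∎)
      (begin
        B 5 ∙ t           ≡⟨ cong (B 5 ∙_) B4≡t ⟨
        B 5 ∙ B 4         ≡⟨ ∙-comm (B 5) (B 4) ⟩
        B 4 ∙ B 5         ≡⟨ cong (B 4 ∙_) (B.cross 4) ⟨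
        B 4 ∙ (B 4 ⨯ B 6) ≡⟨ ∙-⨯ˡ (B 4) (B 6) ⟩
        0ℤ                ≡⟨ trans (∙-comm e₁ t) (∙-e₁ 0ℤ 1ℤ x) ⟨
        e₁ ∙ t            ∎)
      where
      g = gap (2 ℕ.+ ℓ)
      index : ∀ n → n ℕ.+ 6 ≡ 5 ℕ.+ (n ℕ.+ 1)
      index = ℕ-Solver.solve-∀
      value : ∀ y → e₁ ∙ ⟨ y , 1ℤ , 0ℤ ⟩ ≡ y
      value y = trans (∙-comm e₁ ⟨ y , 1ℤ , 0ℤ ⟩) (∙-e₁ y 1ℤ 0ℤ)

    B-end≡e₃ : B (gap (2 ℕ.+ ℓ)) ≡ e₃
    B-end≡e₃ = ∙-injective-frame qht-unimodular
      (begin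
        B g ∙ q            ≡⟨ cong (B g ∙_) FB.L-0 ⟨
        B g ∙ B 0          ≡⟨ ∙-comm (B g) (B 0) ⟩
        B 0 ∙ B g          ≡⟨ cong (λ n → B 0 ∙ B n) (ℕ.+-identityʳ g) ⟨
        B 0 ∙ B (g ℕ.+ 0)  ≡⟨ RB.vanish₁ 0 ⟩
        0ℤ                 ≡⟨ trans (∙-comm e₃ q) (∙-e₃ y 1ℤ 0ℤ) ⟨
        e₃ ∙ q             ∎)
      (begin
        B g ∙ h    ≡⟨ cong (B g ∙_) (FB.L-2+ 0) ⟨
        B g ∙ B 2  ≡⟨ ∙-comm (B g) (B 2) ⟩
        B 2 ∙ B g  ≡⟨ RB.last (ℕ.+-comm 2 (gap (suc ℓ))) ⟩
        1ℤ         ≡⟨ trans (∙-comm e₃ h) (∙-e₃ 1ℤ κ 1ℤ) ⟨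
        e₃ ∙ h     ∎)
      (begin
        B g ∙ t              ≡⟨ cong (B g ∙_) B4≡t ⟨
        B g ∙ B 4            ≡⟨ cong (B g ∙_) (RB.period 4) ⟨
        B g ∙ B (g ℕ.+ 5)    ≡⟨ RB.entry 1 (s≤s z≤n) (ℕ.+-comm g 5) refl ⟩
        β 1 (suc g)          ≡⟨ β-column 1 0 (index g) ⟩
        b 1 (d + 0ℤ)         ≡⟨ cong (b 1) (+-identityʳ d) ⟩
        b 1 d                ≡⟨ x≡b ⟨
        x                    ≡⟨ trans (∙-comm e₃ t) (∙-e₃ 0ℤ 1ℤ x) ⟨
        e₃ ∙ t               ∎)
      where
      g = gap (2 ℕ.+ ℓ)
      index : ∀ n → 1 ℕ.+ n ≡ n ℕ.+ 1 ℕ.+ 0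
      index = ℕ-Solver.solve-∀

    B-end′≡q : B (suc (gap (2 ℕ.+ ℓ))) ≡ q
    B-end′≡q = trans (cong B (ℕ.+-comm 1 (gap (2 ℕ.+ ℓ)))) (trans (RB.period 0) FB.L-0)

    -- `A⁺` leads from `e₃`, `q` to `t`, `e₁`, and `B⁺` from there back to `e₃`, `q`. Together they
    -- close up to a cycle.
    A⁺ B⁺ U : ℕ → ℤ³
    A⁺ j = A (4 ℕ.+ j)
    B⁺ j = B (4 ℕ.+ j)
    U = glue (gap M) A⁺ B⁺

    N = gap M ℕ.+ gap ℓ

    glue₀ : A⁺ (gap M) ≡ B⁺ 0
    glue₀ = trans A-end≡t (sym B4≡t)

    glue₁ : A⁺ (suc (gap M)) ≡ B⁺ 1
    glue₁ = trans A-end′≡e₁ (sym B5≡e₁)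

    U-left : ∀ j → j ℕ.≤ suc (gap M) → U j ≡ A⁺ j
    U-left = glue-left (gap M) glue₀ glue₁

    U-right : ∀ i → U (gap M ℕ.+ i) ≡ B⁺ i
    U-right = glue-right (gap M) A⁺

    wrap₀ : U N ≡ U 0
    wrap₀ = trans (U-right (gap ℓ)) (trans B-end≡e₃ (trans (sym A4≡e₃) (sym (U-left 0 z≤n))))

    wrap₁ : U (suc N) ≡ U 1
    wrap₁ = trans (cong U (sym (ℕ.+-suc (gap M) (gap ℓ))))
      (trans (U-right (suc (gap ℓ))) (trans B-end′≡q (trans (sym A5≡q) (sym (U-left 1 (s≤s z≤n))))))


    -- Only three vectors occur, so the relation survives both seams. The witness `T` stands in for
    -- `unit`, a relation of wider span that `cross⇒unit` recovers.
    Consecutive : ℤ³ → ℤ³ → ℤ³ → Set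
    Consecutive X Y Z = X ⨯ Z ≡ Y × ∃ λ T → Y ∙ T ≡ 1ℤ

    fan-consecutive : ∀ {L} → Fan L → ∀ j → Consecutive (L j) (L (1 ℕ.+ j)) (L (2 ℕ.+ j))
    fan-consecutive {L} fan j = Fan.cross fan j , L (4 ℕ.+ j) , Fan.unit fan (suc j)

    U-consecutive : ∀ j → Consecutive (U j) (U (1 ℕ.+ j)) (U (2 ℕ.+ j))
    U-consecutive = glue-consecutive Consecutive (λ j → fan-consecutive FB.isFan (4 ℕ.+ j))
      (gap M) (λ j → fan-consecutive FA.isFan (4 ℕ.+ j)) glue₀ glue₁

    open PeriodicExtension N U wrap₀ wrap₁ using (W; W≡U; period; consecutive)

    W-consecutive : ∀ k → Consecutive (W k) (W (1ℤ + k)) (W (+ 2 + k))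
    W-consecutive = consecutive Consecutive (λ j _ → U-consecutive j)

    W-cross : ∀ k → W k ⨯ W (+ 2 + k) ≡ W (1ℤ + k)
    W-cross k = proj₁ (W-consecutive k)

    W-unit : ∀ k → W k ∙ W (+ 3 + k) ≡ 1ℤ
    W-unit k = cross⇒unit (W k) (W (1ℤ + k)) (W (+ 2 + k)) (W (+ 3 + k)) (proj₁ (proj₂ (W-consecutive k)))
      (W-cross k) (subst₂ (λ p q → W (1ℤ + k) ⨯ W p ≡ W q) (index₃ k) (index₂ k) (W-cross (1ℤ + k)))
      (proj₂ (proj₂ (W-consecutive k)))
      where
      index₂ : ∀ k → 1ℤ + (1ℤ + k) ≡ + 2 + k
      index₂ = solve-∀
      index₃ : ∀ k → + 2 + (1ℤ + k) ≡ + 3 + k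
      index₃ = solve-∀

    N-≡ : + N ≡ + 2 * + (m ℕ.+ ℓ) + + 8
    N-≡ = trans (cong₂ (λ p q → + p + + q) (gap-≡ M) (gap-≡ ℓ)) (lemma (+ m) (+ ℓ))
      where
      lemma : ∀ m ℓ → + 3 + (1ℤ + m + (1ℤ + m)) + (+ 3 + (ℓ + ℓ)) ≡ + 2 * (m + ℓ) + + 8
      lemma = solve-∀

  -- The shift `M` places the seams in row `M`: columns 0 and 1 contain `e₃ ∙ t` and `q ∙ e₁` there,
  -- that is, `x` and `y`.
  w : Array
  w = fanArray W (+ M)

  w-closed : IsClosed2Frieze (m ℕ.+ ℓ) w
  w-closed = FanArray.fan-closed W (+ M) W-cross W-unit (m ℕ.+ ℓ)
    (λ k → trans (cong (λ n → W (k + n)) (sym N-≡)) (period k))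

  -- Both indices lie between 0 and `gap M + 1`, in the stretch taken from `A`. The argument `s` is
  -- `M - i` without truncated subtraction.
  w-upper : ∀ ε → ε ℕ.≤ 1 → ∀ i s → i ℕ.+ s ≡ M → w i (+ ε) ≡ a i (c + + ε)
  w-upper ε ε≤1 i s i+s≡M = begin
    W (+ ε - + i + + M) ∙ W (+ ε + + 3 + + i + + M)
      ≡⟨ cong₂ _∙_ (trans (W≡U 0ℤ below₁ index₁) (U-left (ε ℕ.+ s) bound₁))
                   (trans (W≡U 0ℤ below₂ index₂) (U-left (ε ℕ.+ 3 ℕ.+ i ℕ.+ M) bound₂)) ⟩
    A (4 ℕ.+ (ε ℕ.+ s)) ∙ A (4 ℕ.+ (ε ℕ.+ 3 ℕ.+ i ℕ.+ M))
      ≡⟨ RA.entry i (ℕ.m≤n⇒m≤1+n i≤M) row refl ⟩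
    α i (i ℕ.+ (4 ℕ.+ (ε ℕ.+ s)))   ≡⟨ α-column i ε column ⟩
    a i (c + + ε)                   ∎
    where
    i≤M : i ℕ.≤ M
    i≤M = ℕ.m+n≤o⇒m≤o i (ℕ.≤-reflexive i+s≡M)
    index₁ : + ε - + i + + M ≡ + (ε ℕ.+ s) + 0ℤ * + N
    index₁ = trans (cong (λ n → + ε - + i + + n) (sym i+s≡M)) (lemma (+ ε) (+ i) (+ s) (+ N))
      where
      lemma : ∀ e i s n → e - i + (i + s) ≡ e + s + 0ℤ * n
      lemma = solve-∀
    index₂ : + ε + + 3 + + i + + M ≡ + (ε ℕ.+ 3 ℕ.+ i ℕ.+ M) + 0ℤ * + N
    index₂ = lemma (+ ε + + 3 + + i + + M) (+ N)
      where
      lemma : ∀ j n → j ≡ j + 0ℤ * n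
      lemma = solve-∀
    bound₂ : ε ℕ.+ 3 ℕ.+ i ℕ.+ M ℕ.≤ suc (gap M)
    bound₂ = subst (ε ℕ.+ 3 ℕ.+ i ℕ.+ M ℕ.≤_) (cong suc (trans (ℕ.+-assoc 3 M M) (sym (gap-≡ M))))
      (ℕ.+-monoˡ-≤ M (ℕ.+-mono-≤ (ℕ.+-monoˡ-≤ 3 ε≤1) i≤M))
    bound₁ : ε ℕ.+ s ℕ.≤ suc (gap M)
    bound₁ = ℕ.≤-trans (ℕ.+-mono-≤ (ℕ.m≤m+n ε 3) s≤) (ℕ.≤-trans (ℕ.≤-reflexive (rearrange ε i s))
      (subst (λ n → ε ℕ.+ 3 ℕ.+ i ℕ.+ n ℕ.≤ suc (gap M)) (sym i+s≡M) bound₂))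
      where
      s≤ : s ℕ.≤ i ℕ.+ i ℕ.+ s
      s≤ = ℕ.m≤n+m s (i ℕ.+ i)
      rearrange : ∀ ε i s → ε ℕ.+ 3 ℕ.+ (i ℕ.+ i ℕ.+ s) ≡ ε ℕ.+ 3 ℕ.+ i ℕ.+ (i ℕ.+ s)
      rearrange = ℕ-Solver.solve-∀
    gapM≤N : suc (gap M) ℕ.≤ suc N
    gapM≤N = s≤s (ℕ.m≤m+n (gap M) (gap ℓ))
    below₁ = ℕ.≤-trans bound₁ gapM≤N
    below₂ = ℕ.≤-trans bound₂ gapM≤N
    row : 4 ℕ.+ (ε ℕ.+ 3 ℕ.+ i ℕ.+ M) ≡ gap i ℕ.+ (4 ℕ.+ (ε ℕ.+ s))
    row = trans (cong (λ n → 4 ℕ.+ (ε ℕ.+ 3 ℕ.+ i ℕ.+ n)) (sym i+s≡M))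
      (trans (lemma ε i s) (cong (ℕ._+ (4 ℕ.+ (ε ℕ.+ s))) (sym (gap-≡ i))))
      where
      lemma : ∀ ε i s → 4 ℕ.+ (ε ℕ.+ 3 ℕ.+ i ℕ.+ (i ℕ.+ s)) ≡ 3 ℕ.+ (i ℕ.+ i) ℕ.+ (4 ℕ.+ (ε ℕ.+ s))
      lemma = ℕ-Solver.solve-∀
    column : i ℕ.+ (4 ℕ.+ (ε ℕ.+ s)) ≡ 4 ℕ.+ M ℕ.+ ε
    column = trans (lemma ε i s) (cong (λ n → 4 ℕ.+ n ℕ.+ ε) i+s≡M)
      where
      lemma : ∀ ε i s → i ℕ.+ (4 ℕ.+ (ε ℕ.+ s)) ≡ 4 ℕ.+ (i ℕ.+ s) ℕ.+ ε
      lemma = ℕ-Solver.solve-∀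

  -- The first index is `ε - i`; moved on by the period `N`, it lies like the second one in the
  -- stretch taken from `B`.
  w-lower : ∀ ε → ε ℕ.≤ 1 → ∀ i s → i ℕ.+ s ≡ ℓ → w (m ℕ.+ suc i) (+ ε) ≡ b (suc i) (d + + ε)
  w-lower ε ε≤1 i s i+s≡ℓ = begin
    W (+ ε - + (m ℕ.+ suc i) + + M) ∙ W (+ ε + + 3 + + (m ℕ.+ suc i) + + M)
      ≡⟨ cong₂ _∙_ (trans (W≡U -1ℤ below₁ index₁) (U-right j)) (trans (W≡U 0ℤ below₂ index₂) (U-right (ε ℕ.+ i))) ⟩
    B (4 ℕ.+ j) ∙ B (4 ℕ.+ (ε ℕ.+ i))
      -- In `B` the second vector precedes the first; a period of `B` restores the order that
      -- `entry` requires.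
      ≡⟨ cong (B (4 ℕ.+ j) ∙_) (RB.period (4 ℕ.+ (ε ℕ.+ i))) ⟨
    B (4 ℕ.+ j) ∙ B (gap (2 ℕ.+ ℓ) ℕ.+ (5 ℕ.+ (ε ℕ.+ i)))
      ≡⟨ RB.entry (suc i) (s≤s i≤ℓ) row refl ⟩
    β (suc i) (suc i ℕ.+ (4 ℕ.+ j))  ≡⟨ β-column (suc i) ε column ⟩
    b (suc i) (d + + ε)              ∎
    where
    i≤ℓ : i ℕ.≤ ℓ
    i≤ℓ = ℕ.m+n≤o⇒m≤o i (ℕ.≤-reflexive i+s≡ℓ)
    j = 3 ℕ.+ (s ℕ.+ s) ℕ.+ i ℕ.+ ε
    gap-ℓ : gap ℓ ≡ 3 ℕ.+ (i ℕ.+ s ℕ.+ (i ℕ.+ s))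
    gap-ℓ = trans (gap-≡ ℓ) (cong (λ n → 3 ℕ.+ (n ℕ.+ n)) (sym i+s≡ℓ))
    index₁ : + ε - + (m ℕ.+ suc i) + + M ≡ + (gap M ℕ.+ j) + -1ℤ * + N
    index₁ = trans (lemma (+ ε) (+ m) (+ i) (+ s) (+ gap M))
      (cong (λ n → + (gap M ℕ.+ j) + -1ℤ * + (gap M ℕ.+ n)) (sym gap-ℓ))
      where
      lemma : ∀ e m i s g → e - (m + (1ℤ + i)) + (1ℤ + m) ≡
              g + (+ 3 + (s + s) + i + e) + -1ℤ * (g + (+ 3 + (i + s + (i + s))))
      lemma = solve-∀
    index₂ : + ε + + 3 + + (m ℕ.+ suc i) + + M ≡ + (gap M ℕ.+ (ε ℕ.+ i)) + 0ℤ * + N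
    index₂ = trans (lemma (+ ε) (+ m) (+ i) (+ N))
      (cong (λ n → + (n ℕ.+ (ε ℕ.+ i)) + 0ℤ * + N) (sym (gap-≡ M)))
      where
      lemma : ∀ e m i n → e + + 3 + (m + (1ℤ + i)) + (1ℤ + m) ≡ + 3 + (1ℤ + m + (1ℤ + m)) + (e + i) + 0ℤ * n
      lemma = solve-∀
    j≤ : j ℕ.≤ suc (gap ℓ)
    j≤ = ℕ.≤-trans (ℕ.+-monoʳ-≤ (3 ℕ.+ (s ℕ.+ s) ℕ.+ i) ε≤1)
      (ℕ.≤-trans (ℕ.m≤m+n (3 ℕ.+ (s ℕ.+ s) ℕ.+ i ℕ.+ 1) i)
        (ℕ.≤-reflexive (trans (lemma i s) (cong suc (sym gap-ℓ)))))
      where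
      lemma : ∀ i s → 3 ℕ.+ (s ℕ.+ s) ℕ.+ i ℕ.+ 1 ℕ.+ i ≡ 1 ℕ.+ (3 ℕ.+ (i ℕ.+ s ℕ.+ (i ℕ.+ s)))
      lemma = ℕ-Solver.solve-∀
    below : ∀ {k} → k ℕ.≤ suc (gap ℓ) → gap M ℕ.+ k ℕ.≤ suc N
    below k≤ = ℕ.≤-trans (ℕ.+-monoʳ-≤ (gap M) k≤) (ℕ.≤-reflexive (ℕ.+-suc (gap M) (gap ℓ)))
    below₁ = below j≤
    below₂ : gap M ℕ.+ (ε ℕ.+ i) ℕ.≤ suc N
    below₂ = below (ℕ.≤-trans (ℕ.≤-trans (ℕ.≤-reflexive (ℕ.+-comm ε i)) (ℕ.+-monoˡ-≤ ε (ℕ.m≤n+m i (3 ℕ.+ (s ℕ.+ s))))) j≤)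
    row : gap (2 ℕ.+ ℓ) ℕ.+ (5 ℕ.+ (ε ℕ.+ i)) ≡ gap (suc i) ℕ.+ (4 ℕ.+ j)
    row = trans (cong (λ n → 4 ℕ.+ n ℕ.+ (5 ℕ.+ (ε ℕ.+ i))) gap-ℓ)
      (trans (lemma ε i s) (cong (λ n → 2 ℕ.+ n ℕ.+ (4 ℕ.+ j)) (sym (gap-≡ i))))
      where
      lemma : ∀ ε i s → 4 ℕ.+ (3 ℕ.+ (i ℕ.+ s ℕ.+ (i ℕ.+ s))) ℕ.+ (5 ℕ.+ (ε ℕ.+ i)) ≡
              2 ℕ.+ (3 ℕ.+ (i ℕ.+ i)) ℕ.+ (4 ℕ.+ (3 ℕ.+ (s ℕ.+ s) ℕ.+ i ℕ.+ ε))
      lemma = ℕ-Solver.solve-∀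
    column : suc i ℕ.+ (4 ℕ.+ j) ≡ gap (2 ℕ.+ ℓ) ℕ.+ 1 ℕ.+ ε
    column = trans (lemma ε i s) (cong (λ n → 4 ℕ.+ n ℕ.+ 1 ℕ.+ ε) (sym gap-ℓ))
      where
      lemma : ∀ ε i s → 1 ℕ.+ i ℕ.+ (4 ℕ.+ (3 ℕ.+ (s ℕ.+ s) ℕ.+ i ℕ.+ ε)) ≡
              4 ℕ.+ (3 ℕ.+ (i ℕ.+ s ℕ.+ (i ℕ.+ s))) ℕ.+ 1 ℕ.+ ε
      lemma = ℕ-Solver.solve-∀

  w-integral : IsIntegralClosed2Frieze (m ℕ.+ ℓ) w
  w-integral = record
    { isClosed2Frieze = w-closed
    ; positive        = λ where
        i i≤ (+ k)    → ray-positive (right-closed w-closed 0ℤ) (positive 0 z≤n) (positive 1 (s≤s z≤n)) k i i≤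
        -- The leftward ray starts with the known columns 1 and 0, so column `-[1+ k ]` is `2 + k`
        -- steps away.
        i i≤ -[1+ k ] → ray-positive (left-closed w-closed 1ℤ) (positive 1 (s≤s z≤n)) (positive 0 z≤n) (2 ℕ.+ k) i i≤
    }
    where
    positive : ∀ ε → ε ℕ.≤ 1 → ∀ i → i ℕ.≤ suc (m ℕ.+ ℓ) → 0ℤ < w i (+ ε)
    positive ε ε≤1 i i≤ = [ upper , lower ]′ (ℕ.≤-<-connex i m)
      where
      upper : i ℕ.≤ m → 0ℤ < w i (+ ε)
      upper i≤m = subst (0ℤ <_) (sym (w-upper ε ε≤1 i (M ∸ i) (ℕ.m+[n∸m]≡n (ℕ.m≤n⇒m≤1+n i≤m))))
        (IsIntegralClosed2Frieze.positive a-integral i (ℕ.m≤n⇒m≤1+n (ℕ.m≤n⇒m≤1+n i≤m)) _)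
      lower : m ℕ.< i → 0ℤ < w i (+ ε)
      lower m<i = subst (0ℤ <_)
        (sym (trans (cong (λ r → w r (+ ε)) (sym m+1+j≡i)) (w-lower ε ε≤1 j (ℓ ∸ j) (ℕ.m+[n∸m]≡n j≤ℓ))))
        (IsIntegralClosed2Frieze.positive b-integral (suc j) (s≤s j≤ℓ) _)
        where
        j = i ∸ M
        m+1+j≡i : m ℕ.+ suc j ≡ i
        m+1+j≡i = trans (ℕ.+-suc m j) (ℕ.m+[n∸m]≡n m<i)
        j≤ℓ : j ℕ.≤ ℓ
        j≤ℓ = ℕ.≤-trans (ℕ.∸-monoˡ-≤ M i≤) (ℕ.≤-reflexive (ℕ.m+n∸m≡n M ℓ))

-- Congruences and the equivalence.

∣-difference : ∀ {n} z {p q} → n ∣ z + p → n ∣ z + q → p ≡ q [mod n ]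
∣-difference {n} z {p} {q} n∣z+p n∣z+q = subst (n ∣_) (lemma z p q) (∣m∣n⇒∣m-n n∣z+p n∣z+q)
  where
  lemma : ∀ z p q → z + p - (z + q) ≡ p - q
  lemma = solve-∀

mod-euclidean : ∀ {n} p q r → p ≡ q [mod n ] → p ≡ r [mod n ] → q ≡ r [mod n ]
mod-euclidean {n} p q r n∣p-q n∣p-r = subst (n ∣_) (lemma p q r) (∣m∣n⇒∣m-n n∣p-r n∣p-q)
  where
  lemma : ∀ p q r → p - r - (p - q) ≡ q - r
  lemma = solve-∀

mod-∣ : ∀ {n} z {p q} → n ∣ z + p → p ≡ q [mod n ] → n ∣ z + q
mod-∣ {n} z {p} {q} n∣z+p n∣p-q = subst (n ∣_) (lemma z p q) (∣m∣n⇒∣m-n n∣z+p n∣p-q)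
  where
  lemma : ∀ z p q → z + p - (p - q) ≡ z + q
  lemma = solve-∀

-- (x + 1)(y + 1) = x y + (x + y + 1).
product-divides : ∀ {x y} → x ∣ y + 1ℤ → y ∣ x + 1ℤ → x * y ∣ x + y + 1ℤ
product-divides {x} {y} (divides j y+1≡jx) (divides k x+1≡ky) = divides (j * k - 1ℤ) (begin
  x + y + 1ℤ                    ≡⟨ expand x y ⟩
  (y + 1ℤ) * (x + 1ℤ) - x * y   ≡⟨ cong₂ (λ s t → s * t - x * y) y+1≡jx x+1≡ky ⟩
  j * x * (k * y) - x * y       ≡⟨ collect j k x y ⟩
  (j * k - 1ℤ) * (x * y)        ∎)
  where
  open ≡-Reasoning
  expand : ∀ x y → x + y + 1ℤ ≡ (y + 1ℤ) * (x + 1ℤ) - x * y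
  expand = solve-∀
  collect : ∀ j k x y → j * x * (k * y) - x * y ≡ (j * k - 1ℤ) * (x * y)
  collect = solve-∀

theorem4 : (m ℓ : ℕ) → 1 ℕ.≤ m → 1 ℕ.≤ ℓ →
    (a b : Array) → IsIntegralClosed2Frieze m a → IsIntegralClosed2Frieze ℓ b →
    (c d : ℤ) (x y r s u v : ℤ) →
    x ≡ a m c → x ≡ b 1 d →
    y ≡ a m (c + 1ℤ) → y ≡ b 1 (d + 1ℤ) →
    r ≡ a (m ∸ 1) c → s ≡ a (m ∸ 1) (c + 1ℤ) →
    u ≡ b 2 d → v ≡ b 2 (d + 1ℤ) →
    (∃ λ (w : Array) →
    IsIntegralClosed2Frieze ((m ℕ.+ ℓ) ∸ 1) w ×
    ((ε : Fin 2) →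
    (∀ i → i ℕ.≤ m → w i (+ toℕ ε) ≡ a i (c + (+ toℕ ε))) ×
    (∀ i → 1 ℕ.≤ i → i ℕ.≤ suc ℓ → w ((m ∸ 1) ℕ.+ i) (+ toℕ ε) ≡ b i (d + (+ toℕ ε)))))
    ⇔
    ((u ≡ r [mod y ] × r ≡ 1ℤ [mod y ]) × (v ≡ s [mod x ] × s ≡ 1ℤ [mod x ]))
theorem4 (suc m) ℓ _ 1≤ℓ a b a-integral b-integral c d x y r s u v x≡a x≡b y≡a y≡b r≡ s≡ u≡ v≡ =
  mk⇔ necessary sufficient
  where
  a-closed = IsIntegralClosed2Frieze.isClosed2Frieze a-integral
  b-closed = IsIntegralClosed2Frieze.isClosed2Frieze b-integral

  plus-minus : ∀ c → c + 1ℤ - 1ℤ ≡ c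
  plus-minus = solve-∀

  x-right : a (suc m) (c + 0ℤ) ≡ x
  x-right = trans (cong (a (suc m)) (+-identityʳ c)) (sym x≡a)

  y-left : a (suc m) (c + 1ℤ + 0ℤ) ≡ y
  y-left = trans (cong (a (suc m)) (+-identityʳ (c + 1ℤ))) (sym y≡a)

  x∣y+s : x ∣ y + s
  x∣y+s = subst₂ _∣_ x-right (cong₂ _+_ (sym y≡a) (sym s≡)) (last-row-divides (right-closed a-closed c))

  x∣y+v : x ∣ y + v
  x∣y+v = subst₂ _∣_ (trans (cong (b 1) (+-identityʳ d)) (sym x≡b)) (cong₂ _+_ (sym y≡b) (sym v≡))
    (first-row-divides 1≤ℓ (right-closed b-closed d))

  y∣x+r : y ∣ x + r
  y∣x+r = subst₂ _∣_ y-left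
    (cong₂ _+_ (trans (cong (a (suc m)) (plus-minus c)) (sym x≡a)) (trans (cong (a m) (plus-minus c)) (sym r≡)))
    (last-row-divides (left-closed a-closed (c + 1ℤ)))

  y∣x+u : y ∣ x + u
  y∣x+u = subst₂ _∣_ (trans (cong (b 1) (+-identityʳ (d + 1ℤ))) (sym y≡b))
    (cong₂ _+_ (trans (cong (b 1) (plus-minus d)) (sym x≡b)) (trans (cong (b 2) (plus-minus d)) (sym u≡)))
    (first-row-divides 1≤ℓ (left-closed b-closed (d + 1ℤ)))

  u≡r : u ≡ r [mod y ]
  u≡r = ∣-difference x y∣x+u y∣x+r

  v≡s : v ≡ s [mod x ]
  v≡s = ∣-difference y x∣y+v x∣y+s

  necessary : _
  -- The light cone gives the congruences to 1 for `u` and `v`; they pass to `r` and `s` through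
  -- `u≡r` and `v≡s`.
  necessary (w , w-integral , match) =
    (u≡r , mod-euclidean u r 1ℤ u≡r u≡1) , (v≡s , mod-euclidean v s 1ℤ v≡s v≡1)
    where
    upper : (ε : Fin 2) → ∀ i → i ℕ.≤ suc m → w i (+ toℕ ε) ≡ a i (c + (+ toℕ ε))
    upper ε = proj₁ (match ε)

    below : (ε : Fin 2) → w (2 ℕ.+ m) (+ toℕ ε) ≡ b 2 (d + + toℕ ε)
    below ε = trans (cong (λ n → w n (+ toℕ ε)) (ℕ.+-comm 2 m)) (proj₂ (match ε) 2 (s≤s z≤n) (s≤s 1≤ℓ))

    m<m+ℓ : m ℕ.< m ℕ.+ ℓ
    m<m+ℓ = ℕ.m<m+n m 1≤ℓ

    v≡1 : v ≡ 1ℤ [mod x ]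
    v≡1 = subst₂ (λ p n → p ≡ 1ℤ [mod n ]) (trans (below (suc zero)) (sym v≡)) x-right
      (cone-congruence (right-positive a-integral c) (right-positive w-integral 0ℤ) m<m+ℓ
        (upper zero) (upper (suc zero)))

    u≡1 : u ≡ 1ℤ [mod y ]
    u≡1 = subst₂ (λ p n → p ≡ 1ℤ [mod n ]) (trans (below zero) (trans (cong (b 2) (+-identityʳ d)) (sym u≡))) y-left
      -- Mirror image: both friezes are read leftwards, `w` from column 1, so `y` takes the part of
      -- `x` and `u` that of `v`.
      (cone-congruence (left-positive a-integral (c + 1ℤ)) (left-positive w-integral 1ℤ) m<m+ℓ
        (λ i i≤ → trans (upper (suc zero) i i≤) (cong (a i) (sym (+-identityʳ (c + 1ℤ)))))
        (λ i i≤ → trans (upper zero i i≤) (cong (a i) (trans (+-identityʳ c) (sym (plus-minus c))))))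

  sufficient : _
  sufficient ((_ , r≡1) , (_ , s≡1)) = w , w-integral , λ ε →
      (λ i i≤ → w-upper (toℕ ε) (toℕ≤pred[n] ε) i (suc m ∸ i) (ℕ.m+[n∸m]≡n i≤))
    , λ where (suc i) _ (s≤s i≤ℓ) → w-lower (toℕ ε) (toℕ≤pred[n] ε) i (ℓ ∸ i) (ℕ.m+[n∸m]≡n i≤ℓ)
    where
    κ-divides : x * y ∣ x + y + 1ℤ
    κ-divides = product-divides (mod-∣ y x∣y+s s≡1) (mod-∣ x y∣x+r r≡1)
    open Gluing m ℓ a-integral b-integral c d x y (quotient κ-divides)
      x≡a x≡b y≡a y≡b (sym (_∣_.equality κ-divides))
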